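{- Let $m$ and $n$ be positive integers with $n\equiv 3\pmod{4}$. Then \[ \sum_{k=0}^{mn-1}\frac{(1+q^{4k+1})(q^2;q^4)_k^3}{(1+q)(q^4;q^4)_k^3}\, q^k \equiv 0\pmod{\Phi_n(q)^2} \] and \[ \sum_{k=0}^{mn+(n-1)/2}\frac{(1+q^{4k+1})(q^2;q^4)_k^3}{(1+q)(q^4;q^4)_k^3}\, q^k \equiv 0\pmod{\Phi_n(q)^2}. \]
   Context: The $q$-shifted factorial is $(a;q)_0=1$ and $(a;q)_k=(1-a)(1-aq)\cdots(1-aq^{k-1})$ for $k\geqslant 1$. $\Phi_n(q)$ denotes the $n$-th cyclotomic polynomial $\prod_{1\le k\le n,\ \gcd(k,n)=1}(q-\zeta^k)$, with $\zeta$ a primitive $n$-th root of unity. For rational functions $A(q),B(q)$ with rational coefficients, $A(q)\equiv B(q)\pmod{P(q)}$ means that $A(q)-B(q)$ can be written as $P(q)\,U(q)/V(q)$ with polynomials $U,V$ and $V(q)$ relatively prime to $P(q)$. -}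

module Defs where

open import Data.Nat as ℕ using (ℕ; zero; suc; _∸_; _<ᵇ_)
open import Data.Nat.Divisibility using (_∣?_)
open import Data.Rational using (ℚ; 0ℚ; 1ℚ; _+_; _*_; -_)
open import Data.Rational.Properties using (_≟_)
open import Data.List using (List; []; _∷_; _++_; [_]; map; replicate; reverse; dropWhile; length; foldr)
open import Data.Product using (Σ; _×_; _,_; proj₁; proj₂)
open import Data.Bool using (if_then_else_)
open import Relation.Nullary.Decidable using (⌊_⌋)
open import Relation.Binary.PropositionalEquality using (_≡_)

-- Polynomials in q with rational coefficients, as coefficient lists
-- (constant term first).  Equality is coefficientwise (trailing zeros
-- are irrelevant).

Poly : Set
Poly = List ℚ

coeff : Poly → ℕ → ℚ
coeff []      _       = 0ℚ
coeff (a ∷ p) zero    = a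
coeff (a ∷ p) (suc i) = coeff p i

infix 4 _≈P_
_≈P_ : Poly → Poly → Set
p ≈P r = ∀ i → coeff p i ≡ coeff r i

infixl 6 _⊕_
_⊕_ : Poly → Poly → Poly
[]      ⊕ r       = r
(a ∷ p) ⊕ []      = a ∷ p
(a ∷ p) ⊕ (b ∷ r) = (a + b) ∷ (p ⊕ r)

scale : ℚ → Poly → Poly
scale c p = map (c *_) p

negP : Poly → Poly
negP = scale (- 1ℚ)

infixl 7 _⊗_
_⊗_ : Poly → Poly → Poly
[]      ⊗ r = []
(a ∷ p) ⊗ r = scale a r ⊕ (0ℚ ∷ (p ⊗ r))

oneP : Poly
oneP = 1ℚ ∷ []

X : Poly
X = 0ℚ ∷ 1ℚ ∷ []

infixr 8 _^P_
_^P_ : Poly → ℕ → Poly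
p ^P zero  = oneP
p ^P suc k = p ⊗ (p ^P k)

mono : ℕ → ℚ → Poly
mono k c = replicate k 0ℚ ++ [ c ]

strip : Poly → Poly
strip p = reverse (dropWhile (λ x → x ≟ 0ℚ) (reverse p))

lastOr : Poly → ℚ
lastOr []          = 0ℚ
lastOr (a ∷ [])    = a
lastOr (a ∷ b ∷ p) = lastOr (b ∷ p)

divMonicF : ℕ → Poly → Poly → Poly
divMonicF zero    p d = []
divMonicF (suc f) p d =
  let p' = strip p
      d' = strip d
  in if length p' <ᵇ length d'
     then []
     else (let t = mono (length p' ∸ length d') (lastOr p')
           in t ⊕ divMonicF f (p' ⊕ negP (t ⊗ d')) d)

divMonic : Poly → Poly → Poly
divMonic p d = divMonicF (suc (length p)) p d

-- Cyclotomic polynomials, via q^N - 1 = ∏_{d ∣ N} Φ_d(q), i.e.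
-- Φ_N(q) = (q^N - 1) / ∏_{d ∣ N, d < N} Φ_d(q)  (exact division by a
-- monic polynomial).  phis N = [(1,Φ_1), …, (N,Φ_N)].

phis : ℕ → List (ℕ × Poly)
phis zero    = []
phis (suc n) =
  let prev = phis n
      N    = suc n
      den  = foldr (λ dφ acc → if ⌊ proj₁ dφ ∣? N ⌋ then proj₂ dφ ⊗ acc else acc) oneP prev
  in prev ++ [ (N , divMonic ((X ^P N) ⊕ negP oneP) den) ]

lastPoly : List (ℕ × Poly) → Poly
lastPoly []            = []
lastPoly (x ∷ [])      = proj₂ x
lastPoly (x ∷ y ∷ xs)  = lastPoly (y ∷ xs)

Φ : ℕ → Poly
Φ n = lastPoly (phis n)

Frac : Set
Frac = Poly × Poly

num : Frac → Poly
num = proj₁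

den : Frac → Poly
den = proj₂

_+F_ : Frac → Frac → Frac
(a , b) +F (c , d) = ((a ⊗ d) ⊕ (c ⊗ b) , b ⊗ d)

zeroF : Frac
zeroF = ([] , oneP)

RelPrime : Poly → Poly → Set
RelPrime V P = Σ Poly λ a → Σ Poly λ b → (a ⊗ V) ⊕ (b ⊗ P) ≈P oneP

-- A ≡ B (mod P):  A - B = P·U/V with V relatively prime to P.
-- For A = a/b, B = c/d this is  (a d - c b)·V = b d P U.
_≡_mod_ : Frac → Frac → Poly → Set
A ≡ B mod P =
  Σ Poly λ U → Σ Poly λ V → RelPrime V P ×
    (((num A ⊗ den B) ⊕ negP (num B ⊗ den A)) ⊗ V ≈P ((den A ⊗ den B) ⊗ P) ⊗ U)

poch : Poly → Poly → ℕ → Poly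
poch a b zero    = oneP
poch a b (suc k) = poch a b k ⊗ (oneP ⊕ negP (a ⊗ (b ^P k)))

term : ℕ → Frac
term k =
  ( ((oneP ⊕ (X ^P (4 ℕ.* k ℕ.+ 1))) ⊗ (poch (X ^P 2) (X ^P 4) k ^P 3)) ⊗ (X ^P k)
  , (oneP ⊕ X) ⊗ (poch (X ^P 4) (X ^P 4) k ^P 3) )

S : ℕ → Frac
S zero    = zeroF
S (suc c) = S c +F term c

{-# OPTIONS --safe #-}

-- Write n = 4M + 3, N = (n - 1)/2 and ε = q^n - 1, so that ε² ≡ 0 modulo
-- Φ_n(q)².  Split the sum into blocks k = ℓn + j with 0 ≤ j < n.  For j > N the
-- factor (q²;q⁴)_k³ contributes an extra ε³, so it suffices that each partial
-- block 0 ≤ j ≤ N vanishes.  Up to a common unit its terms are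
-- (1 + z) q^j ∏_{ℓn ≤ i < k} ((1 - v)/(1 - u))³ with z = q^(4k+1), v = q^(4i+2),
-- u = q^(4i+4).
-- Put θ = q^n.  Modulo ε² we have (1 - v)³ = (1 - v)(1 - θv)(1 - θ⁻¹v), and
-- likewise for u; thus the block is a very-well-poised sum in base Q = q⁴ with
-- parameters b = yq, c = θyq², d = θ⁻¹yq², e = yq² and a = b², where y = q^(4ℓn).
-- As c = bQ^(M+1), the c-column is up to normalisation the polynomial
-- ∏_{|i| ≤ M} (1 - zQ^i).  The sums with c replaced by bQ^(i+1) satisfy a two-term
-- contiguous relation in i whose leading coefficient is a unit, and the sum with
-- i = 0 telescopes.  Each time the boundary terms contain two factors divisible by
-- ε, hence vanish.
module Submission where

open import Defs
open import Level using (_⊔_; 0ℓ)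
open import Algebra.Bundles using (CommutativeRing; AbelianGroup)
open import Algebra.Structures using (IsAbelianGroup)
import Algebra.Solver.Ring
open import Algebra.Solver.Ring.AlmostCommutativeRing using (_-Raw-AlmostCommutative⟶_; fromCommutativeRing)
open import Data.Bool.Base using (true; false; T; if_then_else_)
open import Data.Integer.Base as ℤ using (ℤ; +_; -[1+_]; _⊖_; +≤+)
import Data.Integer.Properties as ℤ
open import Data.List.Base using ([]; _∷_; _++_; [_]; reverse; dropWhile; length; foldr)
import Data.List.Properties as List
import Data.Maybe.Base as Maybe
open import Data.Nat.Base as ℕ using (ℕ; zero; suc; _∸_; _<ᵇ_)
import Data.Nat.Properties as ℕ
import Data.Nat.Divisibility as ℕ
import Data.Nat.DivMod as ℕ
import Data.Nat.GCD as ℕ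
open import Data.Nat.Solver using (module +-*-Solver)
open import Data.Product.Base using (Σ; _×_; _,_; proj₁; proj₂)
open import Data.Rational.Base as ℚ using (ℚ; 0ℚ; 1ℚ)
import Data.Rational.Properties as ℚ
open import Data.Sum.Base using (_⊎_; inj₁; inj₂)
open import Data.Unit.Base using (tt)
open import Relation.Nullary using (yes; no; ¬_; contradiction)
open import Relation.Nullary.Decidable.Core using (⌊_⌋; dec⇒maybe)
open import Relation.Binary.Bundles using (Setoid)
open import Relation.Binary.Definitions using (tri<; tri≈; tri>)
open import Relation.Binary.Structures using (IsEquivalence)
import Relation.Binary.PropositionalEquality as ≡
import Relation.Binary.Reasoning.Setoid as SetoidReasoning
open ≡ using (_≡_; _≢_)
open +-*-Solver using () renaming (solve to solveℕ; _:=_ to _⊜ℕ_; _:+_ to _⊕ℕ_; _:*_ to _⊗ℕ_; con to conℕ)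

-- Why b and θ are there. With z = bQ^k the very-well-poised factor 1 - aQ^(2k) is (1 - z)(1 + z),
-- and the column of b cancels the 1 - z; what is left is the factor 1 + q^(4k+1) of the sum. The
-- shifts by θ and θ⁻¹ = 2 - θ change nothing modulo ε², yet they put c at an integral distance M +
-- 1 from b in powers of Q, because Q^M q^3 = θ. This is where the residue of n modulo 4 enters.
--
-- Two obstacles shape the rest. Modulo Φ_n(q)² there are zero divisors, so every cancellation needs
-- a unit; 1 - q^j is one whenever n does not divide j, and all exponents that occur have to be
-- checked for this. Moreover (q⁴;q⁴)_k is divisible by Φ_n(q) for k ≥ n, so the terms cannot be
-- reduced one by one: in each block a numerator factor 1 - q^(n(4ℓ+2)) has first to be cancelled
-- against the last denominator factor 1 - q^(n(4ℓ+4)). Freed of ε, the latter is -(4ℓ + 4) to first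
-- order, which is invertible over ℚ.

module IntegerSolver {c ℓ} (R : CommutativeRing c ℓ) where
  open CommutativeRing R
  open import Algebra.Properties.Ring ring
  open import Algebra.Properties.AbelianGroup +-abelianGroup using (⁻¹-∙-comm)
  -- Here `1 ×# 1#` reduces to `1#`, so `1-homo` below holds by `refl`.
  open import Algebra.Properties.Semiring.Mult.TCOptimised semiring renaming (_×_ to _×#_)
  open import Relation.Binary.Reasoning.Setoid setoid

  ι : ℤ → Carrier
  ι (+ n)    = n ×# 1#
  ι -[1+ n ] = - (suc n ×# 1#)

  ι-neg : ∀ i → ι (ℤ.- i) ≈ - ι i
  ι-neg (+ zero)  = sym -0#≈0#
  ι-neg (+ suc n) = refl
  ι-neg -[1+ n ]  = sym (-‿involutive _)

  ι-⊖ : ∀ m n → ι (m ⊖ n) ≈ m ×# 1# - n ×# 1#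
  ι-⊖ m zero = sym (trans (+-congˡ -0#≈0#) (+-identityʳ _))
  ι-⊖ zero (suc n) = sym (+-identityˡ _)
  ι-⊖ (suc m) (suc n) = begin
    ι (suc m ⊖ suc n)                     ≡⟨ ≡.cong ι (ℤ.[1+m]⊖[1+n]≡m⊖n m n) ⟩
    ι (m ⊖ n)                             ≈⟨ ι-⊖ m n ⟩
    a - b                                 ≈⟨ +-congʳ (trans (sym (+-identityˡ _)) (+-congʳ (sym (-‿inverseʳ 1#)))) ⟩
    1# - 1# + a - b                       ≈⟨ +-congʳ (trans (+-assoc _ _ _) (trans (+-congˡ (+-comm _ _)) (sym (+-assoc _ _ _)))) ⟩
    1# + a - 1# - b                       ≈⟨ +-assoc _ _ _ ⟩
    1# + a + (- 1# - b)                   ≈⟨ +-congˡ (⁻¹-∙-comm _ _) ⟩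
    1# + a - (1# + b)                     ≈⟨ +-cong (1+× m 1#) (-‿cong (1+× n 1#)) ⟨
    suc m ×# 1# - suc n ×# 1#               ∎
    where a = m ×# 1#
          b = n ×# 1#

  ι-+ : ∀ i j → ι (i ℤ.+ j) ≈ ι i + ι j
  ι-+ (+ m)    (+ n)    = ×-homo-+ 1# m n
  ι-+ (+ m)    -[1+ n ] = ι-⊖ m (suc n)
  ι-+ -[1+ m ] (+ n)    = trans (ι-⊖ n (suc m)) (+-comm _ _)
  ι-+ -[1+ m ] -[1+ n ] = begin
    - (suc (suc (m ℕ.+ n)) ×# 1#)       ≡⟨ ≡.cong (λ k → - (suc k ×# 1#)) (ℕ.+-suc m n) ⟨
    - ((suc m ℕ.+ suc n) ×# 1#)         ≈⟨ -‿cong (×-homo-+ 1# (suc m) (suc n)) ⟩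
    - (suc m ×# 1# + suc n ×# 1#)        ≈⟨ ⁻¹-∙-comm _ _ ⟨
    - (suc m ×# 1#) - (suc n ×# 1#)      ∎

  ι-*⁺ : ∀ m n → ι (+ m ℤ.* + n) ≈ ι (+ m) * ι (+ n)
  ι-*⁺ m n = trans (reflexive (≡.cong ι (≡.sym (ℤ.pos-* m n)))) (×1-homo-* m n)

  ι-* : ∀ i j → ι (i ℤ.* j) ≈ ι i * ι j
  ι-* (+ m)    (+ n)    = ι-*⁺ m n
  ι-* (+ m)    -[1+ n ] = begin
    ι (+ m ℤ.* -[1+ n ])        ≡⟨ ≡.cong ι (ℤ.neg-distribʳ-* (+ m) (+ suc n)) ⟨
    ι (ℤ.- (+ m ℤ.* + suc n))   ≈⟨ ι-neg (+ m ℤ.* + suc n) ⟩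
    - ι (+ m ℤ.* + suc n)       ≈⟨ -‿cong (ι-*⁺ m (suc n)) ⟩
    - (ι (+ m) * ι (+ suc n))   ≈⟨ -‿distribʳ-* _ _ ⟩
    ι (+ m) * - ι (+ suc n)     ∎
  ι-* -[1+ m ] (+ n)    = begin
    ι (-[1+ m ] ℤ.* + n)        ≡⟨ ≡.cong ι (ℤ.neg-distribˡ-* (+ suc m) (+ n)) ⟨
    ι (ℤ.- (+ suc m ℤ.* + n))   ≈⟨ ι-neg (+ suc m ℤ.* + n) ⟩
    - ι (+ suc m ℤ.* + n)       ≈⟨ -‿cong (ι-*⁺ (suc m) n) ⟩
    - (ι (+ suc m) * ι (+ n))   ≈⟨ -‿distribˡ-* _ _ ⟩
    - ι (+ suc m) * ι (+ n)     ∎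
  ι-* -[1+ m ] -[1+ n ] = begin
    ι (+ suc m ℤ.* + suc n)     ≈⟨ ι-*⁺ (suc m) (suc n) ⟩
    a * b                       ≈⟨ -‿involutive _ ⟨
    - - (a * b)                 ≈⟨ -‿cong (-‿distribʳ-* _ _) ⟩
    - (a * - b)                 ≈⟨ -‿distribˡ-* _ _ ⟩
    - a * - b                   ∎
    where a = ι (+ suc m)
          b = ι (+ suc n)

  morphism : ℤ.+-*-rawRing -Raw-AlmostCommutative⟶ fromCommutativeRing R
  morphism = record
    { ⟦_⟧ = ι ; +-homo = ι-+ ; *-homo = ι-* ; -‿homo = ι-neg ; 0-homo = refl ; 1-homo = refl }

  open Algebra.Solver.Ring ℤ.+-*-rawRing (fromCommutativeRing R) morphism
    (λ i j → Maybe.map (λ i≡j → reflexive (≡.cong ι i≡j)) (dec⇒maybe (i ℤ.≟ j))) public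

-- Units, divisibility and finite sums in a commutative ring.

module RingLemmas {c ℓ} (R : CommutativeRing c ℓ) where
  open CommutativeRing R
  open import Algebra.Definitions.RawMagma *-rawMagma public using (_∣_; _,_)
  open import Algebra.Properties.Semiring.Exp semiring public using (_^_; ^-homo-*; ^-assocʳ; ^-congˡ)
  open import Relation.Binary.Reasoning.Setoid setoid
  open IntegerSolver R using (solve; _:=_; _:+_; _:*_; _:-_; :-_; _:^_; con; Polynomial)

  :1 : ∀ {n} → Polynomial n
  :1 = con (+ 1)

  -- Equality modulo one or two relations: the coefficients of the relations
  -- are supplied, and what remains is an identity for the solver.
  modulo : ∀ {a b x y} → a ≈ b → ∀ u → x ≈ y + u * (a - b) → x ≈ y
  modulo {a} {b} {x} {y} a≈b u eq = begin
    x                  ≈⟨ eq ⟩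
    y + u * (a - b)    ≈⟨ +-congˡ (*-congˡ (+-congʳ a≈b)) ⟩
    y + u * (b - b)    ≈⟨ solve 3 (λ y u b → y :+ u :* (b :- b) := y) refl y u b ⟩
    y                  ∎

  modulo₂ : ∀ {a b a′ b′ x y} → a ≈ b → ∀ u → a′ ≈ b′ → ∀ v →
            x ≈ y + u * (a - b) + v * (a′ - b′) → x ≈ y
  modulo₂ a≈b u a′≈b′ v eq = modulo a≈b u (modulo a′≈b′ v eq)

  Unit : Carrier → Set _
  Unit x = Σ Carrier λ i → x * i ≈ 1#

  Unit-resp : ∀ {x y} → x ≈ y → Unit x → Unit y
  Unit-resp x≈y (i , eq) = i , trans (*-congʳ (sym x≈y)) eq

  Unit-1 : Unit 1#
  Unit-1 = 1# , *-identityˡ 1#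

  Unit-* : ∀ {x y} → Unit x → Unit y → Unit (x * y)
  Unit-* {x} {y} (i , xi) (j , yj) = i * j , modulo₂ xi (y * j) yj 1#
    (solve 4 (λ x i y j → x :* y :* (i :* j) :=
      :1 :+ y :* j :* (x :* i :- :1) :+ :1 :* (y :* j :- :1)) refl x i y j)

  Unit-^ : ∀ {x} n → Unit x → Unit (x ^ n)
  Unit-^ zero    u = Unit-1
  Unit-^ (suc n) u = Unit-* u (Unit-^ n u)

  Unit-∣ : ∀ {x y} → x ∣ y → Unit y → Unit x
  Unit-∣ {x} {y} (z , zx≈y) (i , yi) = z * i , (begin
    x * (z * i)  ≈⟨ solve 3 (λ x z i → x :* (z :* i) := z :* x :* i) refl x z i ⟩
    z * x * i    ≈⟨ *-congʳ zx≈y ⟩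
    y * i        ≈⟨ yi ⟩
    1#           ∎)

  Unit-neg : ∀ {x} → Unit x → Unit (- x)
  Unit-neg {x} (i , xi) = - i , trans (solve 2 (λ x i → :- x :* :- i := x :* i) refl x i) xi

  Unit-cancelʳ : ∀ {x} → Unit x → ∀ {a b} → a * x ≈ b * x → a ≈ b
  Unit-cancelʳ {x} (i , xi) {a} {b} eq = modulo₂ eq i xi (b - a)
    (solve 4 (λ x i a b → a := b :+ i :* (a :* x :- b :* x) :+ (b :- a) :* (x :* i :- :1)) refl x i a b)

  -- The series for 1/(x + r) stops after i - r i², since r² = 0.
  Unit-perturb : ∀ {x r} → r * r ≈ 0# → Unit x → Unit (x + r)
  Unit-perturb {x} {r} rr (i , xi) = i * (1# - r * i) , modulo₂ xi (1# - r * i) rr (- (i * i))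
    (solve 3 (λ x r i → (x :+ r) :* (i :* (:1 :- r :* i)) :=
      :1 :+ (:1 :- r :* i) :* (x :* i :- :1) :+ :- (i :* i) :* (r :* r :- con (+ 0))) refl x r i)

  ^-inverse : ∀ {x y} → x * y ≈ 1# → ∀ n → x ^ n * y ^ n ≈ 1#
  ^-inverse         xy zero    = *-identityˡ 1#
  ^-inverse {x} {y} xy (suc n) = modulo₂ xy (x ^ n * y ^ n) (^-inverse xy n) 1#
    (solve 4 (λ x y a b → x :* a :* (y :* b) :=
      :1 :+ a :* b :* (x :* y :- :1) :+ :1 :* (a :* b :- :1)) refl x y (x ^ n) (y ^ n))

  ^-distrib-* : ∀ x y n → (x * y) ^ n ≈ x ^ n * y ^ n
  ^-distrib-* x y zero    = sym (*-identityˡ 1#)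
  ^-distrib-* x y (suc n) = trans (*-congˡ (^-distrib-* x y n))
    (solve 4 (λ x y a b → x :* y :* (a :* b) := x :* a :* (y :* b)) refl x y (x ^ n) (y ^ n))

  open import Algebra.Properties.Monoid.Mult +-monoid public using () renaming (_×_ to _·_)

  -- The quotient (x ^ k - 1) / (x - 1), which is k to first order at x = 1.
  geometric : ∀ x k → Σ Carrier λ w → (w * (x - 1#) ≈ x ^ k - 1#) × x - 1# ∣ w - k · 1#
  geometric x zero = 0# , trans (zeroˡ _) (sym (-‿inverseʳ 1#)) , (0# , solve 1 (λ x → con (+ 0) :* (x :- :1) := con (+ 0) :- con (+ 0)) refl x)
  geometric x (suc k) with geometric x k
  ... | w , e , (d , f) = x * w + 1#
    , trans (solve 2 (λ x w → (x :* w :+ :1) :* (x :- :1) := x :* (w :* (x :- :1)) :+ (x :- :1)) refl x w)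
        (trans (+-congʳ (*-congˡ e)) (solve 2 (λ x a → x :* (a :- :1) :+ (x :- :1) := x :* a :- :1) refl x (x ^ k)))
    , (w + d , trans (distribʳ _ w d) (trans (+-congˡ f)
        (solve 3 (λ x w n → w :* (x :- :1) :+ (w :- n) := x :* w :+ :1 :- (:1 :+ n)) refl x w (k · 1#))))

  ^-1-∣ : ∀ x {a b} → a ℕ.∣ b → x ^ a - 1# ∣ x ^ b - 1#
  ^-1-∣ x {a} (ℕ.divides-refl k) with geometric (x ^ a) k
  ... | w , e , _ = w , trans e (+-congʳ (trans (^-assocʳ x a k) (reflexive (≡.cong (x ^_) (ℕ.*-comm a k)))))

  ∣-trans : ∀ {x y z} → x ∣ y → y ∣ z → x ∣ z
  ∣-trans = ∣ʳ-trans
    where open import Algebra.Properties.Semigroup.Divisibility *-semigroup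

  ∣-*ˡ : ∀ x {y z} → y ∣ z → y ∣ x * z
  ∣-*ˡ x y∣z = x∣ʳy⇒x∣ʳzy x y∣z
    where open import Algebra.Properties.Semigroup.Divisibility *-semigroup

  ∑ : (ℕ → Carrier) → ℕ → Carrier
  ∑ f zero    = 0#
  ∑ f (suc n) = ∑ f n + f n

  ∑-cong : ∀ {f g} n → (∀ k → k ℕ.< n → f k ≈ g k) → ∑ f n ≈ ∑ g n
  ∑-cong zero    eq = refl
  ∑-cong (suc n) eq = +-cong (∑-cong n (λ k k<n → eq k (ℕ.m<n⇒m<1+n k<n))) (eq n ℕ.≤-refl)

  ∑-linear : ∀ a b f g n → ∑ (λ k → a * f k + b * g k) n ≈ a * ∑ f n + b * ∑ g n
  ∑-linear a b f g zero    = solve 2 (λ a b → con (+ 0) := a :* con (+ 0) :+ b :* con (+ 0)) refl a b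
  ∑-linear a b f g (suc n) = trans (+-congʳ (∑-linear a b f g n))
    (solve 6 (λ a b s t x y → a :* s :+ b :* t :+ (a :* x :+ b :* y) := a :* (s :+ x) :+ b :* (t :+ y))
      refl a b (∑ f n) (∑ g n) (f n) (g n))

  ∑-*ˡ : ∀ a f n → ∑ (λ k → a * f k) n ≈ a * ∑ f n
  ∑-*ˡ a f zero    = sym (zeroʳ a)
  ∑-*ˡ a f (suc n) = trans (+-congʳ (∑-*ˡ a f n)) (sym (distribˡ a _ _))

  ∑-tail : ∀ f {m} → ∑ f m ≈ 0# → ∀ {n} → m ℕ.≤ n → (∀ k → m ℕ.≤ k → k ℕ.< n → f k ≈ 0#) → ∑ f n ≈ 0#
  ∑-tail f {m} sum m≤n vanish = go (ℕ.≤⇒≤′ m≤n) vanish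
    where
    go : ∀ {n} → m ℕ.≤′ n → (∀ k → m ℕ.≤ k → k ℕ.< n → f k ≈ 0#) → ∑ f n ≈ 0#
    go ℕ.≤′-refl       vanish = sum
    go (ℕ.≤′-step m≤n) vanish = trans (+-cong (go m≤n λ k m≤k k<n → vanish k m≤k (ℕ.m<n⇒m<1+n k<n)) (vanish _ (ℕ.≤′⇒≤ m≤n) ℕ.≤-refl)) (+-identityˡ 0#)

  -- The shift relation is asked only below `n`, since the weights it will be applied to are
  -- controlled only where their denominators are units.
  ∑-telescope : ∀ (g h : ℕ → Carrier) n → (∀ k → k ℕ.< n → h (suc k) ≈ g k) →
                ∑ (λ k → g k - h k) (suc n) ≈ g n - h 0
  ∑-telescope g h zero    eq = +-identityˡ _
  ∑-telescope g h (suc n) eq = begin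
    ∑ (λ k → g k - h k) (suc n) + (g (suc n) - h (suc n))
      ≈⟨ +-cong (∑-telescope g h n (λ k k<n → eq k (ℕ.m<n⇒m<1+n k<n))) (+-congˡ (-‿cong (eq n ℕ.≤-refl))) ⟩
    g n - h 0 + (g (suc n) - g n)
      ≈⟨ solve 3 (λ a b c → a :- b :+ (c :- a) := c :- b) refl (g n) (h 0) (g (suc n)) ⟩
    g (suc n) - h 0 ∎

-- Comaximal elements: Bézout identities in a ring.

module Comaximality {c ℓ} (R : CommutativeRing c ℓ) where
  open CommutativeRing R
  open RingLemmas R
  open IntegerSolver R using (solve; _:=_; _:+_; _:*_; _:-_; :-_; _:^_; con)

  Comaximal : Carrier → Carrier → Set _
  Comaximal x y = Σ Carrier λ a → Σ Carrier λ b → a * x + b * y ≈ 1#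

  Comaximal-sym : ∀ {x y} → Comaximal x y → Comaximal y x
  Comaximal-sym (a , b , eq) = b , a , trans (+-comm _ _) eq

  Comaximal-1 : ∀ {y} → Comaximal 1# y
  Comaximal-1 {y} = 1# , 0# , solve 1 (λ y → :1 :* :1 :+ con (+ 0) :* y := :1) refl y

  Comaximal-* : ∀ {x y z} → Comaximal x z → Comaximal y z → Comaximal (x * y) z
  Comaximal-* {x} {y} {z} (a , b , eq) (a′ , b′ , eq′) = a * a′ , a * x * b′ + b , modulo₂ eq 1# eq′ (a * x)
    (solve 7 (λ a b x z a′ b′ y → a :* a′ :* (x :* y) :+ (a :* x :* b′ :+ b) :* z :=
      :1 :+ :1 :* (a :* x :+ b :* z :- :1) :+ a :* x :* (a′ :* y :+ b′ :* z :- :1)) refl a b x z a′ b′ y)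

  Comaximal-∣ : ∀ {x y z} → x ∣ y → Comaximal y z → Comaximal x z
  Comaximal-∣ {x} {y} {z} (w , wx) (a , b , eq) = a * w , b ,
    trans (+-congʳ (trans (*-assoc a w x) (*-congˡ wx))) eq

  -- Multiply the Bézout identity by z: each of a x z and b y z contains both x and y.
  *-∣ : ∀ {x y z} → Comaximal x y → x ∣ z → y ∣ z → x * y ∣ z
  *-∣ {x} {y} {z} (a , b , eq) (u , ux) (v , vy) = a * v + b * u , trans
    (solve 6 (λ a b x y u v → (a :* v :+ b :* u) :* (x :* y) := a :* x :* (v :* y) :+ b :* y :* (u :* x)) refl a b x y u v)
    (trans (+-cong (*-congˡ vy) (*-congˡ ux))
      (modulo eq z (solve 5 (λ a b x y z → a :* x :* z :+ b :* y :* z := z :+ z :* (a :* x :+ b :* y :- :1)) refl a b x y z)))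

-- The quotient ring modulo one element.

module Quotient {c ℓ} (R : CommutativeRing c ℓ) (m : CommutativeRing.Carrier R) where
  open CommutativeRing R
  open RingLemmas R
  open IntegerSolver R using (solve; _:=_; _:+_; _:*_; _:-_; :-_; _:^_; con)
  open Comaximality R
  open import Relation.Binary.Reasoning.Setoid setoid

  infix 4 _~_
  record _~_ (x y : Carrier) : Set (c ⊔ ℓ) where
    constructor multiple
    field
      quotient : Carrier
      equality : x ≈ y + quotient * m

  ≈⇒~ : ∀ {x y} → x ≈ y → x ~ y
  ≈⇒~ {x} {y} eq = multiple 0# (trans eq (solve 2 (λ y m → y := y :+ con (+ 0) :* m) refl y m))

  ~-trans : ∀ {x y z} → x ~ y → y ~ z → x ~ z
  ~-trans (multiple u p) (multiple v r) = multiple (u + v) (trans p (trans (+-congʳ r)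
    (solve 4 (λ u v z m → z :+ v :* m :+ u :* m := z :+ (u :+ v) :* m) refl u v _ m)))

  ~-sym : ∀ {x y} → x ~ y → y ~ x
  ~-sym {x} {y} (multiple u p) = multiple (- u) (trans
    (solve 3 (λ y u m → y := y :+ u :* m :+ :- u :* m) refl y u m) (+-congʳ (sym p)))

  -- Congruence becomes the equality of a second ring on the same carrier, so the ring lemmas and
  -- the solver work modulo `m` without a choice of representatives.
  quotientRing : CommutativeRing c (c ⊔ ℓ)
  quotientRing = record
    { Carrier = Carrier ; _≈_ = _~_ ; _+_ = _+_ ; _*_ = _*_ ; -_ = -_ ; 0# = 0# ; 1# = 1#
    ; isCommutativeRing = record
      { isRing = record
        { +-isAbelianGroup = record
          { isGroup = record
            { isMonoid = record
              { isSemigroup = record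
                { isMagma = record
                  { isEquivalence = record { refl = ≈⇒~ refl ; sym = ~-sym ; trans = ~-trans }
                  ; ∙-cong = λ { {x} {y} {x′} {y′} (multiple u p) (multiple v r) → multiple (u + v) (trans (+-cong p r)
                      (solve 5 (λ y z u v m → y :+ u :* m :+ (z :+ v :* m) := y :+ z :+ (u :+ v) :* m) refl y y′ u v m)) } }
                ; assoc = λ x y z → ≈⇒~ (+-assoc x y z) }
              ; identity = (λ x → ≈⇒~ (+-identityˡ x)) , (λ x → ≈⇒~ (+-identityʳ x)) }
            ; inverse = (λ x → ≈⇒~ (-‿inverseˡ x)) , (λ x → ≈⇒~ (-‿inverseʳ x))
            ; ⁻¹-cong = λ { {x} {y} (multiple u p) → multiple (- u) (trans (-‿cong p)
                (solve 3 (λ y u m → :- (y :+ u :* m) := :- y :+ :- u :* m) refl y u m)) } }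
          ; comm = λ x y → ≈⇒~ (+-comm x y) }
        ; *-cong = λ { {x} {y} {x′} {y′} (multiple u p) (multiple v r) → multiple (y * v + u * y′ + u * v * m) (trans (*-cong p r)
            (solve 5 (λ y z u v m → (y :+ u :* m) :* (z :+ v :* m) := y :* z :+ (y :* v :+ u :* z :+ u :* v :* m) :* m) refl y y′ u v m)) }
        ; *-assoc = λ x y z → ≈⇒~ (*-assoc x y z)
        ; *-identity = (λ x → ≈⇒~ (*-identityˡ x)) , (λ x → ≈⇒~ (*-identityʳ x))
        ; distrib = (λ x y z → ≈⇒~ (distribˡ x y z)) , (λ x y z → ≈⇒~ (distribʳ x y z))
        }
      ; *-comm = λ x y → ≈⇒~ (*-comm x y)
      }
    }

  comaximal⇒unit : ∀ {x} → Comaximal x m → RingLemmas.Unit quotientRing x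
  comaximal⇒unit {x} (a , b , eq) = a , multiple (- b) (trans
    (solve 4 (λ a b x m → x :* a := a :* x :+ b :* m :+ :- b :* m) refl a b x m) (+-congʳ eq))

  unit⇒comaximal : ∀ {x} → RingLemmas.Unit quotientRing x → Comaximal x m
  unit⇒comaximal {x} (i , multiple u p) = i , - u , trans
    (+-congʳ (trans (*-comm i x) p)) (solve 2 (λ u m → :1 :+ u :* m :+ :- u :* m := :1) refl u m)

-- Very-well-poised sums

module WellPoisedSum {c ℓ} (R : CommutativeRing c ℓ) where
  open CommutativeRing R
  open RingLemmas R
  open IntegerSolver R using (solve; _:=_; _:+_; _:*_; _:-_; :-_; _:^_; con)
  open import Relation.Binary.Reasoning.Setoid setoid

  -- Read z k = bQ^k, D = d/b and E = e/b with a = b². Then 1 - dQ^k is 1 - Dz and 1 - aQ^(k+1)/d is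
  -- (D - Qz)/D; clearing D and E from the denominators avoids their inverses.
  module Contiguity (Q Q⁻¹ D E : Carrier) (QQ⁻¹ : Q * Q⁻¹ ≈ 1#)
           (z z⁻¹ W : ℕ → Carrier) (zz⁻¹ : ∀ k → z k * z⁻¹ k ≈ 1#)
           (z-suc : ∀ k → z (suc k) ≈ Q * z k) (z⁻¹-suc : ∀ k → z⁻¹ (suc k) ≈ Q⁻¹ * z⁻¹ k)
           where

    -- p i k = ∏_{|j| ≤ i} (1 - z_k Q^j) is the column of c = bQ^(i+1); the columns of
    -- d and e are in W.
    p : ℕ → ℕ → Carrier
    p zero    k = 1# - z k
    p (suc i) k = p i k * ((1# - z k * Q ^ suc i) * (1# - z k * Q⁻¹ ^ suc i))

    -- From z to Qz the window of exponents -i, ..., i moves up by one: the bottom factor 1 -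
    -- zQ^(-i) leaves and 1 - zQ^(i+1) enters.
    p-shift : ∀ i k → p i (suc k) * (1# - z k * Q⁻¹ ^ i) ≈ p i k * (1# - z k * Q ^ suc i)
    p-shift zero k = begin
      (1# - z (suc k)) * (1# - z k * 1#)    ≈⟨ *-congʳ (+-congˡ (-‿cong (z-suc k))) ⟩
      (1# - Q * z k) * (1# - z k * 1#)
        ≈⟨ solve 2 (λ Q z → (:1 :- Q :* z) :* (:1 :- z :* :1) := (:1 :- z) :* (:1 :- z :* (Q :* :1))) refl Q (z k) ⟩
      (1# - z k) * (1# - z k * (Q * 1#))    ∎
    p-shift (suc i) k = begin
      P′ * ((1# - z (suc k) * (Q * q)) * (1# - z (suc k) * (Q⁻¹ * q⁻¹))) * (1# - Z * (Q⁻¹ * q⁻¹))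
        ≈⟨ *-congʳ (*-congˡ (*-cong (+-congˡ (-‿cong (*-congʳ (z-suc k)))) (+-congˡ (-‿cong (*-congʳ (z-suc k)))))) ⟩
      P′ * ((1# - Q * Z * (Q * q)) * (1# - Q * Z * (Q⁻¹ * q⁻¹))) * (1# - Z * (Q⁻¹ * q⁻¹))
        ≈⟨ modulo QQ⁻¹ (- (P′ * (1# - Q * Z * (Q * q)) * (1# - Z * (Q⁻¹ * q⁻¹)) * Z * q⁻¹))
             (solve 6 (λ P Q q Q⁻¹ q⁻¹ Z →
               P :* ((:1 :- Q :* Z :* (Q :* q)) :* (:1 :- Q :* Z :* (Q⁻¹ :* q⁻¹))) :* (:1 :- Z :* (Q⁻¹ :* q⁻¹))
               := P :* (:1 :- Z :* q⁻¹) :* ((:1 :- Z :* (Q :* (Q :* q))) :* (:1 :- Z :* (Q⁻¹ :* q⁻¹)))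
                  :+ :- (P :* (:1 :- Q :* Z :* (Q :* q)) :* (:1 :- Z :* (Q⁻¹ :* q⁻¹)) :* Z :* q⁻¹) :* (Q :* Q⁻¹ :- :1))
               refl P′ Q q Q⁻¹ q⁻¹ Z) ⟩
      P′ * (1# - Z * q⁻¹) * ((1# - Z * (Q * (Q * q))) * (1# - Z * (Q⁻¹ * q⁻¹)))
        ≈⟨ *-congʳ (p-shift i k) ⟩
      p i k * (1# - Z * (Q * q)) * ((1# - Z * (Q * (Q * q))) * (1# - Z * (Q⁻¹ * q⁻¹)))
        ≈⟨ solve 4 (λ P a b c → P :* a :* (b :* c) := P :* (a :* c) :* b) refl (p i k)
             (1# - Z * (Q * q)) (1# - Z * (Q * (Q * q))) (1# - Z * (Q⁻¹ * q⁻¹)) ⟩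
      p i k * ((1# - Z * (Q * q)) * (1# - Z * (Q⁻¹ * q⁻¹))) * (1# - Z * (Q * (Q * q))) ∎
      where q = Q ^ i
            q⁻¹ = Q⁻¹ ^ i
            Z = z k
            P′ = p i (suc k)

    -- The power of z⁻¹ carries the dependence on c of the argument a²Q/(bcde) of the series; for
    -- the parameters of a block this argument is q.
    h : ℕ → ℕ → Carrier
    h i k = (1# + z k) * (p i k * z⁻¹ k ^ suc i)

    module _ (N : ℕ)
             (W-suc : ∀ k → k ℕ.< N → W (suc k) * ((D - Q * z k) * (E - Q * z k)) ≈ W k * ((1# - D * z k) * (1# - E * z k)) * Q)
             (lower : (D - z 0) * (E - z 0) ≈ 0#)
             (upper : (1# - D * z N) * (1# - E * z N) ≈ 0#) where

      H : ℕ → Carrier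
      H i = ∑ (λ k → W k * h i k) (suc N)

      -- `x` and `y` are free multipliers, the certificate of the telescoping: one choice gives the
      -- base case, another the contiguous relation.
      telescope : ∀ (x y : ℕ → Carrier) →
        (∀ k → k ℕ.< N → W (suc k) * ((D - z (suc k)) * (E - z (suc k))) * y (suc k) ≈ W k * ((1# - D * z k) * (1# - E * z k)) * x k) →
        ∑ (λ k → W k * ((1# - D * z k) * (1# - E * z k)) * x k - W k * ((D - z k) * (E - z k)) * y k) (suc N) ≈ 0#
      telescope x y eq = begin
        _ ≈⟨ ∑-telescope (λ k → W k * ((1# - D * z k) * (1# - E * z k)) * x k) (λ k → W k * ((D - z k) * (E - z k)) * y k) N eq ⟩
        W N * ((1# - D * z N) * (1# - E * z N)) * x N - W 0 * ((D - z 0) * (E - z 0)) * y 0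
          ≈⟨ +-cong (*-congʳ (*-congˡ upper)) (-‿cong (*-congʳ (*-congˡ lower))) ⟩
        W N * 0# * x N - W 0 * 0# * y 0
          ≈⟨ solve 4 (λ a b c d → a :* con (+ 0) :* b :- c :* con (+ 0) :* d := con (+ 0)) refl (W N) (x N) (W 0) (y 0) ⟩
        0# ∎

      W-suc′ : ∀ k → k ℕ.< N → W (suc k) * ((D - z (suc k)) * (E - z (suc k))) ≈ W k * ((1# - D * z k) * (1# - E * z k)) * Q
      W-suc′ k k<N = trans (*-congˡ (*-cong (+-congˡ (-‿cong (z-suc k))) (+-congˡ (-‿cong (z-suc k))))) (W-suc k k<N)

      H-zero : (1# - D * E) * H 0 ≈ 0#
      H-zero = begin
        (1# - D * E) * H 0                                  ≈⟨ ∑-*ˡ _ _ (suc N) ⟨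
        ∑ (λ k → (1# - D * E) * (W k * h 0 k)) (suc N)      ≈⟨ ∑-cong (suc N) (λ k _ → difference k) ⟨
        _                                                   ≈⟨ telescope z⁻¹ z⁻¹ step ⟩
        0#                                                  ∎
        where
        -- This is (1 - Dz)(1 - Ez) - (D - z)(E - z) = (1 - DE)(1 - z)(1 + z).
        difference : ∀ k → W k * ((1# - D * z k) * (1# - E * z k)) * z⁻¹ k - W k * ((D - z k) * (E - z k)) * z⁻¹ k
                         ≈ (1# - D * E) * (W k * h 0 k)
        difference k = solve 5 (λ W D E z z⁻¹ →
          W :* ((:1 :- D :* z) :* (:1 :- E :* z)) :* z⁻¹ :- W :* ((D :- z) :* (E :- z)) :* z⁻¹ :=
          (:1 :- D :* E) :* (W :* ((:1 :+ z) :* ((:1 :- z) :* (z⁻¹ :* :1))))) refl (W k) D E (z k) (z⁻¹ k)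
        step : ∀ k → k ℕ.< N → _
        step k k<N = trans (*-cong (W-suc′ k k<N) (z⁻¹-suc k))
          (modulo QQ⁻¹ (W k * ((1# - D * z k) * (1# - E * z k)) * z⁻¹ k)
            (solve 4 (λ w Q Q⁻¹ z⁻¹ → w :* Q :* (Q⁻¹ :* z⁻¹) := w :* z⁻¹ :+ w :* z⁻¹ :* (Q :* Q⁻¹ :- :1))
              refl (W k * ((1# - D * z k) * (1# - E * z k))) Q Q⁻¹ (z⁻¹ k)))

      μ : ℕ → Carrier
      μ i = (1# - q * D * E) * (q + Q⁻¹ ^ suc i - 1#) + (D * E + D * q + E * q - D - E - q)
        where q = Q ^ suc i

      H-suc : ∀ i → (1# - Q ^ suc i * D * E) * H (suc i) + μ i * H i ≈ 0#
      H-suc i = begin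
        (1# - q * D * E) * H (suc i) + μ i * H i
          ≈⟨ ∑-linear _ _ _ _ (suc N) ⟨
        ∑ (λ k → (1# - q * D * E) * (W k * h (suc i) k) + μ i * (W k * h i k)) (suc N)
          ≈⟨ ∑-cong (suc N) (λ k _ → difference k) ⟨
        _ ≈⟨ telescope (λ k → p i k * (1# - z k * q) * z⁻¹ k ^ suc (suc i))
                       (λ k → p i k * (q - z k) * z⁻¹ k ^ suc (suc i)) step ⟩
        0# ∎
        where
        q = Q ^ suc i
        q⁻¹ = Q⁻¹ ^ suc i
        -- As a cubic in z the left side is palindromic, hence 1 + z times a palindromic quadratic;
        -- such quadratics are spanned by (1 - zq)(1 - zq⁻¹) and z. The constant term gives 1 - qDE,
        -- and `μ i` is the coefficient left for z.
        bracket : ∀ k → (1# - D * z k) * (1# - E * z k) * (1# - z k * q) - (D - z k) * (E - z k) * (q - z k)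
                      ≈ (1# + z k) * ((1# - q * D * E) * ((1# - z k * q) * (1# - z k * q⁻¹)) + μ i * z k)
        bracket k = modulo (^-inverse QQ⁻¹ (suc i)) (- ((1# + z k) * (1# - q * D * E) * z k * z k))
          (solve 5 (λ D E z q q⁻¹ →
             (:1 :- D :* z) :* (:1 :- E :* z) :* (:1 :- z :* q) :- (D :- z) :* (E :- z) :* (q :- z)
             := (:1 :+ z) :* ((:1 :- q :* D :* E) :* ((:1 :- z :* q) :* (:1 :- z :* q⁻¹))
                 :+ ((:1 :- q :* D :* E) :* (q :+ q⁻¹ :- :1) :+ (D :* E :+ D :* q :+ E :* q :- D :- E :- q)) :* z)
                :+ :- ((:1 :+ z) :* (:1 :- q :* D :* E) :* z :* z) :* (q :* q⁻¹ :- :1))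
             refl D E (z k) q q⁻¹)
        difference : ∀ k → W k * ((1# - D * z k) * (1# - E * z k)) * (p i k * (1# - z k * q) * z⁻¹ k ^ suc (suc i))
                           - W k * ((D - z k) * (E - z k)) * (p i k * (q - z k) * z⁻¹ k ^ suc (suc i))
                         ≈ (1# - q * D * E) * (W k * h (suc i) k) + μ i * (W k * h i k)
        difference k = begin
          _ ≈⟨ solve 9 (λ w a b P c d a′ b′ e → w :* (a :* b) :* (P :* c :* d) :- w :* (a′ :* b′) :* (P :* e :* d)
                 := w :* P :* d :* (a :* b :* c :- a′ :* b′ :* e)) refl
                 (W k) (1# - D * z k) (1# - E * z k) (p i k) (1# - z k * q) (z⁻¹ k ^ suc (suc i)) (D - z k) (E - z k) (q - z k) ⟩
          W k * p i k * z⁻¹ k ^ suc (suc i) * _ ≈⟨ *-congˡ (bracket k) ⟩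
          W k * p i k * z⁻¹ k ^ suc (suc i) * ((1# + z k) * (κ * t + μ i * z k))
            ≈⟨ modulo (zz⁻¹ k) (W k * p i k * z⁻¹ k ^ suc i * (1# + z k) * μ i)
                 (solve 8 (λ w P z z⁻¹ c κ t μ → w :* P :* (z⁻¹ :* c) :* ((:1 :+ z) :* (κ :* t :+ μ :* z))
                   := κ :* (w :* ((:1 :+ z) :* (P :* t :* (z⁻¹ :* c)))) :+ μ :* (w :* ((:1 :+ z) :* (P :* c)))
                      :+ w :* P :* c :* (:1 :+ z) :* μ :* (z :* z⁻¹ :- :1)) refl
                   (W k) (p i k) (z k) (z⁻¹ k) (z⁻¹ k ^ suc i) κ t (μ i)) ⟩
          κ * (W k * h (suc i) k) + μ i * (W k * h i k) ∎
          where κ = 1# - q * D * E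
                t = (1# - z k * q) * (1# - z k * q⁻¹)
        -- q - Qz = Q(Q^i - z), and together with the outer Q the powers combine to Q² (Q⁻¹)^(i+2) =
        -- Q^(-i); this produces exactly the factor that `p-shift` exchanges.
        shift : ∀ k → Q * (p i (suc k) * (q - z (suc k)) * z⁻¹ (suc k) ^ suc (suc i))
                    ≈ p i k * (1# - z k * q) * z⁻¹ k ^ suc (suc i)
        shift k = begin
          Q * (p i (suc k) * (q - z (suc k)) * z⁻¹ (suc k) ^ suc (suc i))
            ≈⟨ *-congˡ (*-cong (*-congˡ (+-congˡ (-‿cong (z-suc k)))) (trans (^-congˡ (suc (suc i)) (z⁻¹-suc k)) (^-distrib-* _ _ (suc (suc i))))) ⟩
          Q * (p i (suc k) * (Q * s - Q * z k) * (Q⁻¹ * (Q⁻¹ * s⁻¹) * d))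
            ≈⟨ modulo₂ QQ⁻¹ (P * (s - z k) * s⁻¹ * d * (Q * Q⁻¹ + 1#)) (^-inverse QQ⁻¹ i) (P * d)
                 (solve 7 (λ P Q Q⁻¹ s s⁻¹ d z → Q :* (P :* (Q :* s :- Q :* z) :* (Q⁻¹ :* (Q⁻¹ :* s⁻¹) :* d))
                   := P :* (:1 :- z :* s⁻¹) :* d :+ P :* (s :- z) :* s⁻¹ :* d :* (Q :* Q⁻¹ :+ :1) :* (Q :* Q⁻¹ :- :1)
                      :+ P :* d :* (s :* s⁻¹ :- :1)) refl P Q Q⁻¹ s s⁻¹ d (z k)) ⟩
          p i (suc k) * (1# - z k * s⁻¹) * d
            ≈⟨ *-congʳ (p-shift i k) ⟩
          p i k * (1# - z k * q) * d ∎
          where s = Q ^ i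
                s⁻¹ = Q⁻¹ ^ i
                d = z⁻¹ k ^ suc (suc i)
                P = p i (suc k)
        step : ∀ k → k ℕ.< N → _
        step k k<N = trans (*-congʳ (W-suc′ k k<N)) (trans (*-assoc _ _ _) (*-congˡ (shift k)))

      -- The recurrence is solved upwards, so only the coefficient of `H (suc i)` has to be a unit;
      -- nothing is asked of `μ i`.
      H≈0 : ∀ m → (∀ i → i ℕ.≤ m → Unit (1# - Q ^ i * D * E)) → H m ≈ 0#
      H≈0 zero    units = Unit-cancelʳ (Unit-resp (solve 2 (λ D E → :1 :- :1 :* D :* E := :1 :- D :* E) refl D E) (units 0 ℕ.z≤n))
        (trans (*-comm _ _) (trans H-zero (sym (zeroˡ _))))
      H≈0 (suc i) units = Unit-cancelʳ (units (suc i) ℕ.≤-refl) (begin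
        H (suc i) * κ                    ≈⟨ solve 3 (λ x κ μ → x :* κ := κ :* x :+ μ :* con (+ 0)) refl _ κ (μ i) ⟩
        κ * H (suc i) + μ i * 0#         ≈⟨ +-congˡ (*-congˡ (H≈0 i (λ j j≤i → units j (ℕ.m≤n⇒m≤1+n j≤i)))) ⟨
        κ * H (suc i) + μ i * H i        ≈⟨ H-suc i ⟩
        0#                               ≈⟨ zeroˡ κ ⟨
        0# * κ                           ∎)
        where κ = 1# - Q ^ suc i * D * E

-- First-order arithmetic at 1, with ε² = 0.

module FirstOrder {c ℓ} (R : CommutativeRing c ℓ) (ε : CommutativeRing.Carrier R)
                  (ε²≈0 : CommutativeRing._≈_ R (CommutativeRing._*_ R ε ε) (CommutativeRing.0# R)) where
  open CommutativeRing R
  open RingLemmas R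
  open IntegerSolver R using (solve; _:=_; _:+_; _:*_; _:-_; :-_; _:^_; con)
  open import Relation.Binary.Reasoning.Setoid setoid

  ε∣-*≈0 : ∀ {x y} → ε ∣ x → ε ∣ y → x * y ≈ 0#
  ε∣-*≈0 {x} {y} (a , ax) (b , by) = begin
    x * y               ≈⟨ *-cong ax by ⟨
    a * ε * (b * ε)     ≈⟨ modulo ε²≈0 (a * b) (solve 3 (λ a b ε → a :* ε :* (b :* ε) := con (+ 0) :+ a :* b :* (ε :* ε :- con (+ 0))) refl a b ε) ⟩
    0#                  ∎

  _≈₁1 : Carrier → Set _
  x ≈₁1 = ε ∣ x - 1#

  ≈₁-* : ∀ {x y} → x ≈₁1 → y ≈₁1 → (x * y) ≈₁1
  ≈₁-* {x} {y} (a , ax) (b , by) = a * y + b , (begin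
    (a * y + b) * ε                ≈⟨ solve 4 (λ a b y ε → (a :* y :+ b) :* ε := a :* ε :* y :+ b :* ε) refl a b y ε ⟩
    a * ε * y + b * ε              ≈⟨ +-cong (*-congʳ ax) by ⟩
    (x - 1#) * y + (y - 1#)        ≈⟨ solve 2 (λ x y → (x :- :1) :* y :+ (y :- :1) := x :* y :- :1) refl x y ⟩
    x * y - 1#                     ∎)

  ≈₁-1 : 1# ≈₁1
  ≈₁-1 = 0# , trans (zeroˡ ε) (sym (-‿inverseʳ 1#))

  ≈₁-^ : ∀ {x} n → x ≈₁1 → (x ^ n) ≈₁1
  ≈₁-^ zero    p = ≈₁-1
  ≈₁-^ (suc n) p = ≈₁-* p (≈₁-^ n p)

  ≈₁-neg : ∀ {x} → x ≈₁1 → ε ∣ 1# - x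
  ≈₁-neg {x} (a , ax) = - a , (begin
    - a * ε       ≈⟨ solve 2 (λ a ε → :- a :* ε := :- (a :* ε)) refl a ε ⟩
    - (a * ε)     ≈⟨ -‿cong ax ⟩
    - (x - 1#)    ≈⟨ solve 1 (λ x → :- (x :- :1) := :1 :- x) refl x ⟩
    1# - x        ∎)

  ≈₁-inverse : ∀ {x} → x ≈₁1 → x * (1# + 1# - x) ≈ 1#
  ≈₁-inverse {x} p = modulo (ε∣-*≈0 p p) (- 1#)
    (solve 1 (λ x → x :* (:1 :+ :1 :- x) := :1 :+ :- :1 :* ((x :- :1) :* (x :- :1) :- con (+ 0))) refl x)

  -- 1 - yx and 1 - x differ by (y - 1)x, whose square is zero. So factors such as y, θ and θ⁻¹ can
  -- be ignored in questions about units.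
  Unit-≈₁ : ∀ {x y} → y ≈₁1 → Unit (1# - x) → Unit (1# - y * x)
  Unit-≈₁ {x} {y} y₁ u = Unit-resp (solve 2 (λ x y → :1 :- x :+ :- ((y :- :1) :* x) := :1 :- y :* x) refl x y)
    (Unit-perturb (modulo (ε∣-*≈0 y₁ y₁) (x * x)
      (solve 2 (λ x y → :- ((y :- :1) :* x) :* :- ((y :- :1) :* x) := con (+ 0) :+ x :* x :* ((y :- :1) :* (y :- :1) :- con (+ 0))) refl x y)) u)

-- 4(M + 1) = (4M + 3) + 1, so M + 1 inverts 4 modulo 4M + 3.
4M+3∣4a⇒∣a : ∀ M a → 4 ℕ.* M ℕ.+ 3 ℕ.∣ 4 ℕ.* a → 4 ℕ.* M ℕ.+ 3 ℕ.∣ a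
4M+3∣4a⇒∣a M a ∣4a = ℕ.∣m+n∣m⇒∣n (≡.subst (4 ℕ.* M ℕ.+ 3 ℕ.∣_)
    (solveℕ 2 (λ M a → (conℕ 1 ⊕ℕ M) ⊗ℕ (conℕ 4 ⊗ℕ a) ⊜ℕ (conℕ 4 ⊗ℕ M ⊕ℕ conℕ 3) ⊗ℕ a ⊕ℕ a) ≡.refl M a)
    (ℕ.∣n⇒∣m*n (suc M) ∣4a)) (ℕ.m∣m*n a)

-- The partial block as a very-well-poised sum.

module BlockSum {c ℓ} (R : CommutativeRing c ℓ) where
  open CommutativeRing R
  open RingLemmas R

  module AtRoot
    (q q⁻¹ : Carrier) (qq⁻¹ : q * q⁻¹ ≈ 1#) (M : ℕ)
    (ε²≈0 : (q ^ (4 ℕ.* M ℕ.+ 3) - 1#) * (q ^ (4 ℕ.* M ℕ.+ 3) - 1#) ≈ 0#)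
    (unit : ∀ j → ¬ (4 ℕ.* M ℕ.+ 3 ℕ.∣ j) → Unit (1# - q ^ j)) where
    open IntegerSolver R using (solve; _:=_; _:+_; _:*_; _:-_; :-_; _:^_; con)
    open import Relation.Binary.Reasoning.Setoid setoid

    n N : ℕ
    n = 4 ℕ.* M ℕ.+ 3
    N = 2 ℕ.* M ℕ.+ 1

    -- D = d / b and E = e / b.
    θ ε θ⁻¹ Q Q⁻¹ D E : Carrier
    θ = q ^ n
    ε = θ - 1#
    θ⁻¹ = 1# + 1# - θ
    Q = q ^ 4
    Q⁻¹ = q⁻¹ ^ 4
    D = θ⁻¹ * q
    E = q

    open FirstOrder R ε ε²≈0

    θ≈₁1 : θ ≈₁1
    θ≈₁1 = 1# , *-identityˡ ε

    θ⁻¹≈₁1 : θ⁻¹ ≈₁1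
    θ⁻¹≈₁1 = - 1# , solve 1 (λ θ → :- :1 :* (θ :- :1) := :1 :+ :1 :- θ :- :1) refl θ

    θθ⁻¹ : θ * θ⁻¹ ≈ 1#
    θθ⁻¹ = ≈₁-inverse θ≈₁1

    q^4i+r : ∀ i r → q ^ (4 ℕ.* i ℕ.+ r) ≈ Q ^ i * q ^ r
    q^4i+r i r = trans (^-homo-* q (4 ℕ.* i) r) (*-congʳ (sym (^-assocʳ q 4 i)))

    QQ⁻¹ : Q * Q⁻¹ ≈ 1#
    QQ⁻¹ = ^-inverse qq⁻¹ 4

    -- The shape of n enters here: θ = q^(4M+3) = Q^M q^3.
    Q⁻¹^M : Q⁻¹ ^ M ≈ θ⁻¹ * q ^ 3
    Q⁻¹^M = begin
      Q⁻¹ ^ M                              ≈⟨ modulo θθ⁻¹ (- (Q⁻¹ ^ M)) (solve 3 (λ a θ θ⁻¹ → a := a :* (θ :* θ⁻¹) :+ :- a :* (θ :* θ⁻¹ :- :1)) refl (Q⁻¹ ^ M) θ θ⁻¹) ⟩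
      Q⁻¹ ^ M * (θ * θ⁻¹)                  ≈⟨ *-congˡ (*-congʳ (q^4i+r M 3)) ⟩
      Q⁻¹ ^ M * (Q ^ M * q ^ 3 * θ⁻¹)      ≈⟨ modulo (^-inverse QQ⁻¹ M) (θ⁻¹ * q ^ 3)
                                                (solve 4 (λ a b c d → a :* (b :* c :* d) := d :* c :+ d :* c :* (b :* a :- :1)) refl _ _ _ _) ⟩
      θ⁻¹ * q ^ 3                          ∎

    module _ (y : Carrier) (y≈₁1 : y ≈₁1) where
      y⁻¹ : Carrier
      y⁻¹ = 1# + 1# - y

      z z⁻¹ : ℕ → Carrier
      z k = y * (Q ^ k * q ^ 1)
      z⁻¹ k = y⁻¹ * (Q⁻¹ ^ k * q⁻¹ ^ 1)

      z-suc : ∀ k → z (suc k) ≈ Q * z k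
      z-suc k = solve 4 (λ y Q a q → y :* (Q :* a :* q :^ 1) := Q :* (y :* (a :* q :^ 1))) refl y Q (Q ^ k) q

      z⁻¹-suc : ∀ k → z⁻¹ (suc k) ≈ Q⁻¹ * z⁻¹ k
      z⁻¹-suc k = solve 4 (λ y Q a q → y :* (Q :* a :* q :^ 1) := Q :* (y :* (a :* q :^ 1))) refl y⁻¹ Q⁻¹ (Q⁻¹ ^ k) q⁻¹

      zz⁻¹ : ∀ k → z k * z⁻¹ k ≈ 1#
      zz⁻¹ k = begin
        y * (Q ^ k * q ^ 1) * (y⁻¹ * (Q⁻¹ ^ k * q⁻¹ ^ 1))
          ≈⟨ solve 6 (λ a b c a′ b′ c′ → a :* (b :* c) :* (a′ :* (b′ :* c′)) := (a :* a′) :* ((b :* b′) :* (c :* c′))) refl _ _ _ _ _ _ ⟩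
        y * y⁻¹ * (Q ^ k * Q⁻¹ ^ k * (q ^ 1 * q⁻¹ ^ 1))
          ≈⟨ *-cong (≈₁-inverse y≈₁1) (*-cong (^-inverse QQ⁻¹ k) (^-inverse qq⁻¹ 1)) ⟩
        1# * (1# * 1#)
          ≈⟨ solve 0 (:1 :* (:1 :* :1) := :1) refl ⟩
        1# ∎

      zQ^j : ∀ k j → z k * Q ^ j ≈ z (k ℕ.+ j)
      zQ^j k j = begin
        y * (Q ^ k * q ^ 1) * Q ^ j     ≈⟨ solve 4 (λ y a b q → y :* (a :* q) :* b := y :* (a :* b :* q)) refl _ _ _ _ ⟩
        y * (Q ^ k * Q ^ j * q ^ 1)     ≈⟨ *-congˡ (*-congʳ (^-homo-* Q k j)) ⟨
        z (k ℕ.+ j)                     ∎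

      u v : ℕ → Carrier
      u k = z k * q ^ 3
      v k = z k * q

      small : ∀ {i} → 0 ℕ.< i → i ℕ.< n → ¬ n ℕ.∣ i
      small {suc i} _ i<n = ℕ.>⇒∤ i<n

      unit-u : ∀ k → k ℕ.< N → Unit (1# - u k)
      unit-u k k<N = Unit-resp (+-congˡ (-‿cong (begin
          y * q ^ (4 ℕ.* suc k ℕ.+ 0)   ≈⟨ *-congˡ (q^4i+r (suc k) 0) ⟩
          y * (Q ^ suc k * 1#)          ≈⟨ solve 3 (λ y q a → y :* (q :^ 4 :* a :* :1) := y :* (a :* q :^ 1) :* q :^ 3) refl y q (Q ^ k) ⟩
          u k                           ∎)))
        (Unit-≈₁ y≈₁1 (unit _ λ n∣ → small (ℕ.s≤s ℕ.z≤n) (ℕ.<-≤-trans (ℕ.s≤s k<N) N<n)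
          (4M+3∣4a⇒∣a M (suc k) (≡.subst (n ℕ.∣_) (ℕ.+-identityʳ _) n∣))))
        where
        N<n : suc N ℕ.≤ n
        N<n = ≡.subst (suc N ℕ.≤_) (solveℕ 1 (λ M → conℕ 1 ⊕ℕ (conℕ 2 ⊗ℕ M ⊕ℕ conℕ 1) ⊕ℕ (conℕ 2 ⊗ℕ M ⊕ℕ conℕ 1) ⊜ℕ conℕ 4 ⊗ℕ M ⊕ℕ conℕ 3) ≡.refl M) (ℕ.m≤m+n (suc N) N)

      unit-Qq : ∀ i r → 0 ℕ.< r → 4 ℕ.* i ℕ.+ r ℕ.< n → Unit (1# - Q ^ i * q ^ r)
      unit-Qq i r 0<r i<n = Unit-resp (+-congˡ (-‿cong (q^4i+r i r))) (unit _ (small (ℕ.<-≤-trans 0<r (ℕ.m≤n+m r (4 ℕ.* i))) i<n))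

      below : ∀ {i r} → i ℕ.≤ M → r ℕ.< 3 → 4 ℕ.* i ℕ.+ r ℕ.< n
      below i≤M r<3 = ℕ.+-mono-≤-< (ℕ.*-monoʳ-≤ 4 i≤M) r<3

      unit-z₊ : ∀ j → j ℕ.≤ M → Unit (1# - z 0 * Q ^ j)
      unit-z₊ j j≤M = Unit-resp (+-congˡ (-‿cong (sym (zQ^j 0 j))))
        (Unit-≈₁ y≈₁1 (unit-Qq j 1 (ℕ.s≤s ℕ.z≤n) (below j≤M (ℕ.s≤s (ℕ.s≤s ℕ.z≤n)))))

      -- The exponent is negative: x = q^(-(4j+3)). With w = q^(4j+3) its inverse, 1 - x = -x(1 -
      -- w), and 0 < 4j + 3 < n.
      unit-z₋ : ∀ j → j ℕ.< M → Unit (1# - z 0 * Q⁻¹ ^ suc j)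
      unit-z₋ j j<M = Unit-resp (+-congˡ (-‿cong (solve 3 (λ y q a → y :* (q :* a) := y :* (:1 :* q :^ 1) :* a) refl y q (Q⁻¹ ^ suc j))))
        (Unit-≈₁ y≈₁1 (Unit-resp reflect (Unit-* (Unit-neg (w , xw)) (unit-Qq j 3 (ℕ.s≤s ℕ.z≤n) (ℕ.+-monoˡ-< 3 (ℕ.*-monoʳ-< 4 j<M))))))
        where
        x w : Carrier
        x = q * Q⁻¹ ^ suc j
        w = Q ^ j * q ^ 3
        xw : x * w ≈ 1#
        xw = trans (solve 3 (λ q a b → q :* a :* (b :* q :^ 3) := q :^ 4 :* b :* a) refl q (Q⁻¹ ^ suc j) (Q ^ j)) (^-inverse QQ⁻¹ (suc j))
        reflect : - x * (1# - w) ≈ 1# - x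
        reflect = modulo xw 1# (solve 2 (λ x w → :- x :* (:1 :- w) := :1 :- x :+ :1 :* (x :* w :- :1)) refl x w)

      -- DE = θ⁻¹q², so the exponents are 4i + 2, and i ≤ M keeps them at most n - 1.
      unit-Q^iDE : ∀ i → i ℕ.≤ M → Unit (1# - Q ^ i * D * E)
      unit-Q^iDE i i≤M = Unit-resp (solve 3 (λ t a q → :1 :- t :* (a :* q :^ 2) := :1 :- a :* (t :* q) :* q) refl θ⁻¹ (Q ^ i) q)
        (Unit-≈₁ θ⁻¹≈₁1 (unit-Qq i 2 (ℕ.s≤s ℕ.z≤n) (below i≤M (ℕ.s≤s (ℕ.s≤s (ℕ.s≤s ℕ.z≤n))))))

      lower : (D - z 0) * (E - z 0) ≈ 0#
      lower = begin
        (D - z 0) * (E - z 0)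
          ≈⟨ solve 3 (λ t y q → (t :* q :- y :* (:1 :* q :^ 1)) :* (q :- y :* (:1 :* q :^ 1)) :=
               (:1 :- y :- (:1 :- t)) :* (:1 :- y) :* (q :* q)) refl θ⁻¹ y q ⟩
        (1# - y - (1# - θ⁻¹)) * (1# - y) * (q * q)
          ≈⟨ *-congʳ (trans (solve 2 (λ a b → (a :- b) :* a := a :* a :- b :* a) refl _ _)
               (+-cong (ε∣-*≈0 (≈₁-neg y≈₁1) (≈₁-neg y≈₁1)) (-‿cong (ε∣-*≈0 (≈₁-neg θ⁻¹≈₁1) (≈₁-neg y≈₁1))))) ⟩
        (0# - 0#) * (q * q) ≈⟨ solve 1 (λ q → (con (+ 0) :- con (+ 0)) :* (q :* q) := con (+ 0)) refl q ⟩
        0# ∎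

      -- 4N + 2 = 2n: at k = N the numerator columns of d and e reach a multiple of n.
      Ez-N : E * z N ≈ y * (θ * θ)
      Ez-N = begin
        q * (y * (Q ^ N * q ^ 1))                    ≈⟨ *-congˡ (*-congˡ (*-congʳ Q^N)) ⟩
        q * (y * (Q ^ M * Q ^ M * Q * q ^ 1))        ≈⟨ solve 3 (λ q y a → q :* (y :* (a :* a :* q :^ 4 :* q :^ 1)) := y :* (a :* q :^ 3 :* (a :* q :^ 3))) refl q y (Q ^ M) ⟩
        y * (Q ^ M * q ^ 3 * (Q ^ M * q ^ 3))        ≈⟨ *-congˡ (*-cong (q^4i+r M 3) (q^4i+r M 3)) ⟨
        y * (θ * θ)                                  ∎
        where
        Q^N : Q ^ N ≈ Q ^ M * Q ^ M * Q
        Q^N = begin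
          Q ^ N                          ≈⟨ ^-homo-* Q (2 ℕ.* M) 1 ⟩
          Q ^ (2 ℕ.* M) * Q ^ 1          ≈⟨ *-cong (^-homo-* Q M (M ℕ.+ 0)) (*-identityʳ Q) ⟩
          Q ^ M * Q ^ (M ℕ.+ 0) * Q      ≈⟨ *-congʳ (*-congˡ (reflexive (≡.cong (Q ^_) (ℕ.+-identityʳ M)))) ⟩
          Q ^ M * Q ^ M * Q              ∎

      upper : (1# - D * z N) * (1# - E * z N) ≈ 0#
      upper = begin
        (1# - θ⁻¹ * q * z N) * (1# - q * z N)
          ≈⟨ *-cong (+-congˡ (-‿cong (trans (*-assoc _ _ _) (*-congˡ Ez-N)))) (+-congˡ (-‿cong Ez-N)) ⟩
        (1# - θ⁻¹ * (y * (θ * θ))) * (1# - y * (θ * θ))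
          ≈⟨ ε∣-*≈0 (≈₁-neg (≈₁-* θ⁻¹≈₁1 yθθ)) (≈₁-neg yθθ) ⟩
        0# ∎
        where
        yθθ : (y * (θ * θ)) ≈₁1
        yθθ = ≈₁-* y≈₁1 (≈₁-* θ≈₁1 θ≈₁1)

      factor : ∀ k → (D - Q * z k) * (E - Q * z k) ≈ θ⁻¹ * q * q * ((1# - θ * u k) * (1# - u k))
      factor k = modulo θθ⁻¹ (q * u k * (E - Q * z k))
        (solve 4 (λ t s q z → (s :* q :- q :^ 4 :* z) :* (q :- q :^ 4 :* z) :=
           s :* q :* q :* ((:1 :- t :* (z :* q :^ 3)) :* (:1 :- z :* q :^ 3))
           :+ q :* (z :* q :^ 3) :* (q :- q :^ 4 :* z) :* (t :* s :- :1)) refl θ θ⁻¹ q (z k))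

      unit-factor : ∀ k → k ℕ.< N → Unit ((D - Q * z k) * (E - Q * z k))
      unit-factor k k<N = Unit-resp (sym (factor k))
        (Unit-* (Unit-* (Unit-* (θ , trans (*-comm _ _) θθ⁻¹) (q⁻¹ , qq⁻¹)) (q⁻¹ , qq⁻¹))
          (Unit-* (Unit-≈₁ θ≈₁1 (unit-u k k<N)) (unit-u k k<N)))

      -- `W` has to be total, but the divisor is known to be a unit only below `N`; past that point
      -- 0# is a placeholder.
      inverse : ∀ k → Σ Carrier λ i → k ℕ.< N → (D - Q * z k) * (E - Q * z k) * i ≈ 1#
      inverse k with k ℕ.<? N
      ... | yes k<N = proj₁ (unit-factor k k<N) , λ _ → proj₂ (unit-factor k k<N)
      ... | no  k≮N = 0# , λ k<N → contradiction k<N k≮N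

      W : ℕ → Carrier
      W zero    = 1#
      W (suc k) = W k * ((1# - D * z k) * (1# - E * z k)) * Q * proj₁ (inverse k)

      W-suc : ∀ k → k ℕ.< N → W (suc k) * ((D - Q * z k) * (E - Q * z k)) ≈ W k * ((1# - D * z k) * (1# - E * z k)) * Q
      W-suc k k<N = modulo (proj₂ (inverse k) k<N) (W k * ((1# - D * z k) * (1# - E * z k)) * Q)
        (solve 3 (λ w i x → w :* i :* x := w :+ w :* (x :* i :- :1)) refl _ _ _)

      open WellPoisedSum R
      open Contiguity Q Q⁻¹ D E QQ⁻¹ z z⁻¹ W zz⁻¹ z-suc z⁻¹-suc

      unit-p : ∀ i → i ℕ.≤ M → Unit (p i 0)
      unit-p zero    i≤M = Unit-resp (+-congˡ (-‿cong (*-identityʳ (z 0)))) (unit-z₊ 0 ℕ.z≤n)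
      unit-p (suc i) i<M = Unit-* (unit-p i (ℕ.<⇒≤ i<M)) (Unit-* (unit-z₊ (suc i) i<M) (unit-z₋ i i<M))

      π : ℕ → Carrier
      π k = p M k * z⁻¹ k ^ suc M

      unit-π : Unit (π 0)
      unit-π = Unit-* (unit-p M ℕ.≤-refl) (Unit-^ (suc M) (z 0 , trans (*-comm _ _) (zz⁻¹ 0)))

      -- Up to the constant θ⁻¹q⁻¹ this is the ratio of the column of c = θyq²: the two ends
      -- exchanged by `p-shift` are zQ^(M+1) = θv and zQ^(-M) = θ⁻¹u.
      π-suc : ∀ k → π (suc k) * (1# - θ⁻¹ * u k) ≈ π k * (1# - θ * v k) * (θ⁻¹ * q⁻¹)
      π-suc k = begin
        p M (suc k) * z⁻¹ (suc k) ^ suc M * (1# - θ⁻¹ * u k)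
          ≈⟨ *-cong (*-congˡ (trans (^-congˡ (suc M) (z⁻¹-suc k)) (^-distrib-* _ _ (suc M)))) (+-congˡ (-‿cong zQ⁻¹^M)) ⟩
        p M (suc k) * (Q⁻¹ * Q⁻¹ ^ M * d) * (1# - z k * Q⁻¹ ^ M)
          ≈⟨ solve 4 (λ p a c b → p :* a :* b := p :* b :* a) refl (p M (suc k)) _ d (1# - z k * Q⁻¹ ^ M) ⟩
        p M (suc k) * (1# - z k * Q⁻¹ ^ M) * (Q⁻¹ * Q⁻¹ ^ M * d)
          ≈⟨ *-cong (p-shift M k) (*-congʳ Q⁻¹^1+M) ⟩
        p M k * (1# - z k * Q ^ suc M) * (θ⁻¹ * q⁻¹ * d)
          ≈⟨ *-congʳ (*-congˡ (+-congˡ (-‿cong zQ^1+M))) ⟩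
        p M k * (1# - θ * v k) * (θ⁻¹ * q⁻¹ * d)
          ≈⟨ solve 4 (λ p a b c → p :* a :* (b :* c) := p :* c :* a :* b) refl _ _ _ _ ⟩
        p M k * d * (1# - θ * v k) * (θ⁻¹ * q⁻¹) ∎
        where
        d = z⁻¹ k ^ suc M
        zQ⁻¹^M : θ⁻¹ * u k ≈ z k * Q⁻¹ ^ M
        zQ⁻¹^M = trans (solve 3 (λ t z q → t :* (z :* q) := z :* (t :* q)) refl θ⁻¹ (z k) (q ^ 3)) (*-congˡ (sym Q⁻¹^M))
        zQ^1+M : z k * Q ^ suc M ≈ θ * v k
        zQ^1+M = trans (solve 3 (λ z q a → z :* (q :^ 4 :* a) := a :* q :^ 3 :* (z :* q)) refl (z k) q (Q ^ M)) (*-congʳ (sym (q^4i+r M 3)))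
        Q⁻¹^1+M : Q⁻¹ * Q⁻¹ ^ M ≈ θ⁻¹ * q⁻¹
        Q⁻¹^1+M = trans (*-congˡ Q⁻¹^M) (modulo (^-inverse qq⁻¹ 3) (θ⁻¹ * q⁻¹)
          (solve 3 (λ q s t → s :^ 4 :* (t :* q :^ 3) := t :* s :+ t :* s :* (q :^ 3 :* s :^ 3 :- :1)) refl q q⁻¹ θ⁻¹))

      -- θ + θ⁻¹ = 2 by the choice of θ⁻¹, and θθ⁻¹ = 1; so (1 - θx)(1 - θ⁻¹x) has the coefficients
      -- of (1 - x)².
      cube : ∀ x → (1# - x) ^ 3 ≈ (1# - x) * (1# - θ * x) * (1# - θ⁻¹ * x)
      cube x = modulo θθ⁻¹ (- ((1# - x) * x * x)) (solve 2 (λ t x → (:1 :- x) :^ 3 :=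
        (:1 :- x) :* (:1 :- t :* x) :* (:1 :- (:1 :+ :1 :- t) :* x) :+ :- ((:1 :- x) :* x :* x) :* (t :* (:1 :+ :1 :- t) :- :1)) refl θ x)

      module _ (τ : ℕ → Carrier) (τ-suc : ∀ k → k ℕ.< N → τ (suc k) * (1# - u k) ^ 3 ≈ τ k * q * (1# - v k) ^ 3) where

        -- Both sides obey the same first-order recurrence: `W` supplies the columns of d and e, `π`
        -- that of c. Here `s` is the constant of `factor`, and Qθ⁻¹q⁻¹ = qs leaves the single q in
        -- the step of `τ`.
        τ-W : ∀ k → k ℕ.≤ N → τ k * π 0 ≈ τ 0 * (W k * π k)
        τ-W zero    _   = *-congˡ (sym (*-identityˡ (π 0)))
        τ-W (suc k) k<N = Unit-cancelʳ (Unit-* (Unit-^ 3 (unit-u k k<N)) (Unit-* (θ , trans (*-comm _ _) θθ⁻¹) (Unit-^ 2 (q⁻¹ , qq⁻¹)))) (begin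
          τ (suc k) * π 0 * ((1# - u k) ^ 3 * s)
            ≈⟨ solve 4 (λ a b c d → a :* b :* (c :* d) := a :* c :* b :* d) refl _ _ _ _ ⟩
          τ (suc k) * (1# - u k) ^ 3 * π 0 * s
            ≈⟨ *-congʳ (*-congʳ (τ-suc k k<N)) ⟩
          τ k * q * (1# - v k) ^ 3 * π 0 * s
            ≈⟨ solve 5 (λ a b c d s → a :* b :* c :* d :* s := a :* d :* (b :* c :* s)) refl _ _ _ _ _ ⟩
          τ k * π 0 * (q * (1# - v k) ^ 3 * s)
            ≈⟨ *-cong (τ-W k (ℕ.<⇒≤ k<N)) (*-congʳ (*-congˡ (cube (v k)))) ⟩
          τ 0 * (W k * π k) * (q * ((1# - v k) * (1# - θ * v k) * (1# - θ⁻¹ * v k)) * (θ⁻¹ * q ^ 2))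
            ≈⟨ modulo qq⁻¹ (- (τ 0 * W k * π k * θ⁻¹ * q ^ 3 * ((1# - v k) * (1# - θ * v k) * (1# - θ⁻¹ * v k))))
                (solve 9 (λ t w p q q′ s a b c → t :* (w :* p) :* (q :* (a :* b :* c) :* (s :* q :^ 2)) :=
                   t :* (w :* (c :* a) :* q :^ 4) :* (p :* b :* (s :* q′))
                   :+ :- (t :* w :* p :* s :* q :^ 3 :* (a :* b :* c)) :* (q :* q′ :- :1)) refl
                   (τ 0) (W k) (π k) q q⁻¹ θ⁻¹ (1# - v k) (1# - θ * v k) (1# - θ⁻¹ * v k)) ⟩
          τ 0 * (W k * ((1# - θ⁻¹ * v k) * (1# - v k)) * Q) * (π k * (1# - θ * v k) * (θ⁻¹ * q⁻¹))
            ≈⟨ *-cong (*-congˡ (trans (*-congʳ (*-congˡ (*-cong (+-congˡ (-‿cong (solve 3 (λ t q z → t :* (z :* q) := t :* q :* z) refl _ _ _))) (+-congˡ (-‿cong (*-comm _ _))))))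
                  (trans (sym (W-suc k k<N)) (*-congˡ (factor k))))) (sym (π-suc k)) ⟩
          τ 0 * (W (suc k) * (θ⁻¹ * q * q * ((1# - θ * u k) * (1# - u k)))) * (π (suc k) * (1# - θ⁻¹ * u k))
            ≈⟨ solve 8 (λ t w s q b a p c → t :* (w :* (s :* q :* q :* (b :* a))) :* (p :* c) := t :* (w :* p) :* (a :* b :* c :* (s :* q :^ 2))) refl
                 (τ 0) (W (suc k)) θ⁻¹ q (1# - θ * u k) (1# - u k) (π (suc k)) (1# - θ⁻¹ * u k) ⟩
          τ 0 * (W (suc k) * π (suc k)) * ((1# - u k) * (1# - θ * u k) * (1# - θ⁻¹ * u k) * s)
            ≈⟨ *-congˡ (*-congʳ (cube (u k))) ⟨
          τ 0 * (W (suc k) * π (suc k)) * ((1# - u k) ^ 3 * s) ∎)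
          where s = θ⁻¹ * q ^ 2

        block-sum : ∑ (λ k → (1# + z k) * τ k) (suc N) ≈ 0#
        block-sum = Unit-cancelʳ unit-π (begin
          ∑ (λ k → (1# + z k) * τ k) (suc N) * π 0         ≈⟨ *-comm _ _ ⟩
          π 0 * ∑ (λ k → (1# + z k) * τ k) (suc N)         ≈⟨ ∑-*ˡ _ _ (suc N) ⟨
          ∑ (λ k → π 0 * ((1# + z k) * τ k)) (suc N)       ≈⟨ ∑-cong (suc N) (λ k k<1+N → begin
              π 0 * ((1# + z k) * τ k)                     ≈⟨ solve 3 (λ a b c → a :* (b :* c) := c :* a :* b) refl _ _ _ ⟩
              τ k * π 0 * (1# + z k)                       ≈⟨ *-congʳ (τ-W k (ℕ.s≤s⁻¹ k<1+N)) ⟩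
              τ 0 * (W k * π k) * (1# + z k)               ≈⟨ solve 4 (λ a b c d → a :* (b :* c) :* d := a :* (b :* (d :* c))) refl _ _ _ _ ⟩
              τ 0 * (W k * h M k)                          ∎) ⟩
          ∑ (λ k → τ 0 * (W k * h M k)) (suc N)            ≈⟨ ∑-*ˡ _ _ (suc N) ⟩
          τ 0 * ∑ (λ k → W k * h M k) (suc N)              ≈⟨ *-congˡ (H≈0 N W-suc lower upper M unit-Q^iDE) ⟩
          τ 0 * 0#                                         ≈⟨ solve 2 (λ a b → a :* con (+ 0) := con (+ 0) :* b) refl (τ 0) (π 0) ⟩
          0# * π 0                                         ∎)

-- The congruence over a general ring

-- The fractions of Defs with X replaced by an element of an arbitrary ring.
module HypergeometricSum {r₁ r₂} (B : CommutativeRing r₁ r₂) (x : CommutativeRing.Carrier B) where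
  open CommutativeRing B
  open RingLemmas B

  poch′ : Carrier → Carrier → ℕ → Carrier
  poch′ a b zero    = 1#
  poch′ a b (suc k) = poch′ a b k * (1# - a * b ^ k)

  numeratorProduct denominatorProduct : ℕ → Carrier
  numeratorProduct = poch′ (x ^ 2) (x ^ 4)
  denominatorProduct = poch′ (x ^ 4) (x ^ 4)

  Fraction : Set r₁
  Fraction = Carrier × Carrier

  infixl 6 _+ᶠ_
  _+ᶠ_ : Fraction → Fraction → Fraction
  (a , b) +ᶠ (a′ , b′) = a * b′ + a′ * b , b * b′

  term′ : ℕ → Fraction
  term′ k = (1# + x ^ (4 ℕ.* k ℕ.+ 1)) * numeratorProduct k ^ 3 * x ^ k , (1# + x) * denominatorProduct k ^ 3

  S′ : ℕ → Fraction
  S′ zero    = 0# , 1#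
  S′ (suc k) = S′ k +ᶠ term′ k

module Supercongruence {r₁ r₂} (B : CommutativeRing r₁ r₂) where
  open CommutativeRing B
  open RingLemmas B
  open Comaximality B

  -- Of Φ_n(q) only divisibility of x^n - 1 and comaximality with the other x^j - 1 are kept. The
  -- invertible integers are for the factor 4ℓ + 4 at the end of a block.
  module AtRoot
    (x φ : Carrier) (M : ℕ)
    (φ∣x^n-1 : φ ∣ x ^ (4 ℕ.* M ℕ.+ 3) - 1#)
    (φ-comaximal : ∀ j → ¬ (4 ℕ.* M ℕ.+ 3 ℕ.∣ j) → Comaximal φ (x ^ j - 1#))
    (·-unit : ∀ k → Unit (suc k · 1#)) where
    open IntegerSolver B using (solve; _:=_; _:+_; _:*_; _:-_; :-_; _:^_; con)

    n N : ℕ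
    n = 4 ℕ.* M ℕ.+ 3
    N = 2 ℕ.* M ℕ.+ 1

    modulus : Carrier
    modulus = φ ^ 2

    open Quotient B modulus

    private
      module A = CommutativeRing quotientRing
      module L = RingLemmas quotientRing
      module I = IntegerSolver quotientRing
    open I using () renaming (_:=_ to _⊜_; _:+_ to _⊞_; _:*_ to _⊠_; _:-_ to _⊟_; _:^_ to _↑_)

    -- The two powers are one recursion instantiated at different ring bundles, so their equality
    -- needs an induction.
    ^ᴬ≡^ : ∀ a k → a L.^ k ≡ a ^ k
    ^ᴬ≡^ a zero    = ≡.refl
    ^ᴬ≡^ a (suc k) = ≡.cong (a *_) (^ᴬ≡^ a k)

    unit-1-x^ : ∀ j → ¬ n ℕ.∣ j → L.Unit (1# - x ^ j)
    unit-1-x^ j n∤j = comaximal⇒unit (Comaximal-sym (Comaximal-* φ-1-x^ (Comaximal-* φ-1-x^ Comaximal-1)))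
      where
      φ-1-x^ : Comaximal φ (1# - x ^ j)
      φ-1-x^ = Comaximal-sym (Comaximal-∣ (- 1# , solve 1 (λ x → :- :1 :* (:1 :- x) := x :- :1) refl (x ^ j))
        (Comaximal-sym (φ-comaximal j n∤j)))

    ε : Carrier
    ε = x L.^ n - 1#

    ε≡ : ε ≡ x ^ n - 1#
    ε≡ = ≡.cong (_- 1#) (^ᴬ≡^ x n)

    ε²~0 : ε * ε ~ 0#
    ε²~0 = ≡.subst (λ ε → ε * ε ~ 0#) (≡.sym ε≡) (square φ∣x^n-1)
      where
      square : ∀ {y} → φ ∣ y → y * y ~ 0#
      square (w , e) = multiple (w * w) (trans (sym (*-cong e e))
        (solve 2 (λ w φ → w :* φ :* (w :* φ) := con (+ 0) :+ w :* w :* (φ :* (φ :* :1))) refl w φ))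

    open FirstOrder quotientRing ε ε²~0

    ∣⇒∣ᴬ : ∀ {a} → x ^ n - 1# ∣ a → ε L.∣ a
    ∣⇒∣ᴬ {a} (w , e) = w L., ≈⇒~ (≡.subst (λ ε → w * ε ≈ a) (≡.sym ε≡) e)

    θ : Carrier
    θ = x L.^ n

    θ≈₁1 : θ ≈₁1
    θ≈₁1 = 1# L., A.*-identityˡ ε

    -- This is x^(n-1)(2 - θ); multiplied by x it becomes θ(2 - θ) = 1.
    x⁻¹ : Carrier
    x⁻¹ = x L.^ (4 ℕ.* M ℕ.+ 2) * (1# + 1# - θ)

    xx⁻¹ : x * x⁻¹ ~ 1#
    xx⁻¹ = A.trans (A.sym (A.*-assoc _ _ _)) (A.trans
      (A.*-congʳ (A.reflexive (≡.cong (x L.^_) (≡.sym (ℕ.+-suc (4 ℕ.* M) 2))))) (≈₁-inverse θ≈₁1))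

    unit-1-xᴬ^ : ∀ j → ¬ n ℕ.∣ j → L.Unit (1# - x L.^ j)
    unit-1-xᴬ^ j n∤j = ≡.subst (λ a → L.Unit (1# - a)) (≡.sym (^ᴬ≡^ x j)) (unit-1-x^ j n∤j)

    open BlockSum.AtRoot quotientRing x x⁻¹ xx⁻¹ M ε²~0 unit-1-xᴬ^ using (z; u; v; q^4i+r; block-sum)

    -- 1 + x divides 1 - x², and n ≥ 3 does not divide 2.
    unit-1+x : L.Unit (1# + x)
    unit-1+x = L.Unit-∣ (1# - x L., ≈⇒~ (solve 1 (λ x → (:1 :- x) :* (:1 :+ x) := :1 :- x :^ 2) refl x))
      (unit-1-x^ 2 (ℕ.>⇒∤ (ℕ.m≤n+m 3 (4 ℕ.* M))))

    numFactor denFactor : ℕ → Carrier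
    numFactor K = 1# - x ^ 2 * (x ^ 4) ^ K
    denFactor K = 1# - x ^ 4 * (x ^ 4) ^ K

    x^r[x^4]^K : ∀ r K → x ^ r * (x ^ 4) ^ K ≈ x ^ (4 ℕ.* K ℕ.+ r)
    x^r[x^4]^K r K = trans (*-comm (x ^ r) _) (trans (*-congʳ (^-assocʳ x 4 K)) (sym (^-homo-* x (4 ℕ.* K) r)))

    numFactor≈ : ∀ K → numFactor K ≈ 1# - x ^ (4 ℕ.* K ℕ.+ 2)
    numFactor≈ K = +-congˡ (-‿cong (x^r[x^4]^K 2 K))

    denFactor≈ : ∀ K → denFactor K ≈ 1# - x ^ (4 ℕ.* K ℕ.+ 4)
    denFactor≈ K = +-congˡ (-‿cong (x^r[x^4]^K 4 K))

    ∣-1-x^ : ∀ {a b} → a ℕ.∣ b → x ^ a - 1# ∣ 1# - x ^ b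
    ∣-1-x^ {a} {b} a∣b with ^-1-∣ x a∣b
    ... | w , e = - w , trans (solve 2 (λ w x → :- w :* x := :- (w :* x)) refl w (x ^ a - 1#))
      (trans (-‿cong e) (solve 1 (λ x → :- (x :- :1) := :1 :- x) refl (x ^ b)))

    open HypergeometricSum B x renaming (numeratorProduct to P; denominatorProduct to R)

    -- The content of `_≡_mod_` with zero on the right, over a general ring.
    Divisible : Fraction → Set _
    Divisible (a , b) = Σ Carrier λ U → Σ Carrier λ V → Comaximal V modulus × a * V ≈ b * modulus * U

    -- F lies in the localisation of B at φ and reduces to w modulo φ ^ 2; the
    -- cross relation is exact since common factors φ of F have to be cancelled.
    record Value (F : Fraction) (w : Carrier) : Set (r₁ ⊔ r₂) where
      constructor value
      field
        numerator denominator : Carrier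
        cross : proj₁ F * denominator ≈ proj₂ F * numerator
        unit  : L.Unit denominator
        ratio : numerator ~ w * denominator

    Value-zero : Value (0# , 1#) 0#
    Value-zero = value 0# 1# (*-comm 0# 1#) L.Unit-1 (A.sym (A.zeroˡ 1#))

    Value-+ : ∀ {F G w w′} → Value F w → Value G w′ → Value (F +ᶠ G) (w + w′)
    Value-+ {a , b} {a′ , b′} {w} {w′} (value x y cr un ra) (value x′ y′ cr′ un′ ra′) = value (x * y′ + x′ * y) (y * y′)
      (modulo₂ cr (b′ * y′) cr′ (b * y)
        (solve 8 (λ a b a′ b′ x y x′ y′ → (a :* b′ :+ a′ :* b) :* (y :* y′) := b :* b′ :* (x :* y′ :+ x′ :* y)
          :+ b′ :* y′ :* (a :* y :- b :* x) :+ b :* y :* (a′ :* y′ :- b′ :* x′)) refl a b a′ b′ x y x′ y′))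
      (L.Unit-* un un′)
      (A.trans (A.+-cong (A.*-congʳ ra) (A.*-congʳ ra′))
        (≈⇒~ (solve 4 (λ w w′ y y′ → w :* y :* y′ :+ w′ :* y′ :* y := (w :+ w′) :* (y :* y′)) refl w w′ y y′)))

    Value-resp : ∀ {F w w′} → w ~ w′ → Value F w → Value F w′
    Value-resp w~w′ (value x y cr un ra) = value x y cr un (A.trans ra (A.*-congʳ w~w′))

    Value-0⇒Divisible : ∀ {F} → Value F 0# → Divisible F
    Value-0⇒Divisible {a , b} (value _ d cr un (multiple w e)) = w , d , unit⇒comaximal un
      , trans cr (trans (*-congˡ e) (solve 4 (λ b d w m → b :* (con (+ 0) :* d :+ w :* m) := b :* m :* w) refl b d w modulus))

    -- The ratio `P K` / `R K` has no pole at φ, although `R K` itself may be divisible by φ. At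
    -- multiples of n this is what one block hands to the next.
    record Regular (K : ℕ) : Set (r₁ ⊔ r₂) where
      constructor regular
      field
        numerator denominator : Carrier
        cross : P K * denominator ≈ R K * numerator
        unit  : L.Unit denominator

    -- One block of n consecutive terms.

    module _ (ℓ : ℕ) (start : Regular (ℓ ℕ.* n)) where
      open Regular start renaming (numerator to x₀; denominator to y₀; cross to cross₀; unit to unit₀)

      s : ℕ
      s = ℓ ℕ.* n

      -- α/β continues the ratio of `P` and `R` from the reduced fraction x₀/y₀, so that β remains a
      -- unit throughout the block.
      α β : ℕ → Carrier
      α zero    = x₀
      α (suc k) = α k * numFactor (s ℕ.+ k)
      β zero    = y₀
      β (suc k) = β k * denFactor (s ℕ.+ k)

      cross : ∀ k → P (s ℕ.+ k) * β k ≈ R (s ℕ.+ k) * α k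
      cross zero    rewrite ℕ.+-identityʳ s = cross₀
      cross (suc k) rewrite ℕ.+-suc s k = modulo (cross k) (a * b)
        (solve 6 (λ p r α β a b → p :* a :* (β :* b) := r :* b :* (α :* a) :+ a :* b :* (p :* β :- r :* α))
          refl (P (s ℕ.+ k)) (R (s ℕ.+ k)) (α k) (β k) a b)
        where a = numFactor (s ℕ.+ k)
              b = denFactor (s ℕ.+ k)

      -- The exponent is 4(ℓn + k + 1) and 4 is invertible modulo n, so within the block a multiple
      -- of n occurs only at k + 1 = n, its last factor.
      unit-denFactor : ∀ k → suc k ℕ.< n → L.Unit (denFactor (s ℕ.+ k))
      unit-denFactor k k<n = L.Unit-resp (≈⇒~ (sym (denFactor≈ (s ℕ.+ k)))) (unit-1-x^ _ n∤)
        where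
        n∤ : ¬ n ℕ.∣ 4 ℕ.* (s ℕ.+ k) ℕ.+ 4
        n∤ n∣ = ℕ.>⇒∤ k<n (ℕ.∣m+n∣m⇒∣n (4M+3∣4a⇒∣a M (s ℕ.+ suc k) (≡.subst (n ℕ.∣_) 4[s+k]+4 n∣)) (ℕ.n∣m*n ℓ))
          where
          4[s+k]+4 : 4 ℕ.* (s ℕ.+ k) ℕ.+ 4 ≡ 4 ℕ.* (s ℕ.+ suc k)
          4[s+k]+4 = solveℕ 2 (λ s k → conℕ 4 ⊗ℕ (s ⊕ℕ k) ⊕ℕ conℕ 4 ⊜ℕ conℕ 4 ⊗ℕ (s ⊕ℕ (conℕ 1 ⊕ℕ k))) ≡.refl s k

      unit-β : ∀ k → k ℕ.< n → L.Unit (β k)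
      unit-β zero    _   = unit₀
      unit-β (suc k) k<n = L.Unit-* (unit-β k (ℕ.<-trans (ℕ.n<1+n k) k<n)) (unit-denFactor k k<n)

      ε∣α : ∀ k → N ℕ.< k → x ^ n - 1# ∣ α k
      ε∣α (suc k) (ℕ.s≤s N≤k) with ℕ.m≤n⇒m<n∨m≡n N≤k
      ... | inj₁ N<k = ∣-trans (ε∣α k N<k) (numFactor (s ℕ.+ k) , *-comm _ (α k))
      ... | inj₂ ≡.refl = ∣-trans (∣-1-x^ (ℕ.divides (4 ℕ.* ℓ ℕ.+ 2) 4[s+N]+2))
          (α k , *-congˡ (sym (numFactor≈ (s ℕ.+ N))))
        where
        4[s+N]+2 : 4 ℕ.* (s ℕ.+ N) ℕ.+ 2 ≡ (4 ℕ.* ℓ ℕ.+ 2) ℕ.* n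
        4[s+N]+2 = solveℕ 2 (λ ℓ M → let n = conℕ 4 ⊗ℕ M ⊕ℕ conℕ 3 in
          conℕ 4 ⊗ℕ (ℓ ⊗ℕ n ⊕ℕ (conℕ 2 ⊗ℕ M ⊕ℕ conℕ 1)) ⊕ℕ conℕ 2 ⊜ℕ (conℕ 4 ⊗ℕ ℓ ⊕ℕ conℕ 2) ⊗ℕ n) ≡.refl ℓ M

      last : ℕ
      last = 4 ℕ.* M ℕ.+ 2

      n≡1+last : n ≡ suc last
      n≡1+last = ℕ.+-suc (4 ℕ.* M) 2

      last<n : last ℕ.< n
      last<n = ℕ.≤-reflexive (≡.sym n≡1+last)

      N<last : N ℕ.< last
      N<last = ℕ.+-mono-≤-< (ℕ.*-monoˡ-≤ M (ℕ.m≤m+n 2 2)) ℕ.≤-refl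

      cofactor : Carrier
      cofactor = proj₁ (geometric (x ^ n) (4 ℕ.+ 4 ℕ.* ℓ))

      denFactor-last : denFactor (s ℕ.+ last) ≈ - (cofactor * (x ^ n - 1#))
      denFactor-last = begin
        denFactor (s ℕ.+ last)                        ≈⟨ denFactor≈ (s ℕ.+ last) ⟩
        1# - x ^ (4 ℕ.* (s ℕ.+ last) ℕ.+ 4)               ≡⟨ ≡.cong (λ i → 1# - x ^ i) 4[s+last]+4 ⟩
        1# - x ^ (n ℕ.* (4 ℕ.+ 4 ℕ.* ℓ))                  ≈⟨ solve 1 (λ x → :1 :- x := :- (x :- :1)) refl _ ⟩
        - (x ^ (n ℕ.* (4 ℕ.+ 4 ℕ.* ℓ)) - 1#)  ≈⟨ -‿cong (+-congʳ (^-assocʳ x n (4 ℕ.+ 4 ℕ.* ℓ))) ⟨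
        - ((x ^ n) ^ (4 ℕ.+ 4 ℕ.* ℓ) - 1#)  ≈⟨ -‿cong (proj₁ (proj₂ (geometric (x ^ n) (4 ℕ.+ 4 ℕ.* ℓ)))) ⟨
        - (cofactor * (x ^ n - 1#))                     ∎
        where
        open SetoidReasoning setoid
        4[s+last]+4 : 4 ℕ.* (s ℕ.+ last) ℕ.+ 4 ≡ n ℕ.* (4 ℕ.+ 4 ℕ.* ℓ)
        4[s+last]+4 = solveℕ 2 (λ ℓ M → let n = conℕ 4 ⊗ℕ M ⊕ℕ conℕ 3 in
          conℕ 4 ⊗ℕ (ℓ ⊗ℕ n ⊕ℕ (conℕ 4 ⊗ℕ M ⊕ℕ conℕ 2)) ⊕ℕ conℕ 4 ⊜ℕ n ⊗ℕ (conℕ 4 ⊕ℕ conℕ 4 ⊗ℕ ℓ)) ≡.refl ℓ M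

      -- To first order at x^n = 1 the cofactor is the integer 4ℓ + 4: a square-zero perturbation of
      -- a unit.
      unit-cofactor : L.Unit cofactor
      unit-cofactor = L.Unit-resp (≈⇒~ (solve 2 (λ k h → k :+ (h :- k) := h) refl _ cofactor))
        (L.Unit-perturb (ε∣-*≈0 ε∣h-k ε∣h-k) (proj₁ (·-unit k) , ≈⇒~ (proj₂ (·-unit k))))
        where
        k = 3 ℕ.+ 4 ℕ.* ℓ
        ε∣h-k : ε L.∣ cofactor - suc k · 1#
        ε∣h-k = ∣⇒∣ᴬ (proj₂ (proj₂ (geometric (x ^ n) (suc k))))

      -- The factor 1 - x^n shared by α last and denFactor (s + last) is cancelled.
      next : Regular (s ℕ.+ n)
      next rewrite ≡.cong (s ℕ.+_) n≡1+last | ℕ.+-suc s last with ε∣α last N<last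
      ... | c , cε = regular (- (c * a)) (β last * cofactor)
        (begin
          P K * a * (β last * cofactor)
            ≈⟨ modulo₂ (cross last) (a * cofactor) (sym cε) (R K * a * cofactor)
                (solve 8 (λ p a β h r α c ε → p :* a :* (β :* h) := r :* :- (h :* ε) :* :- (c :* a)
                  :+ a :* h :* (p :* β :- r :* α) :+ r :* a :* h :* (α :- c :* ε)) refl
                  (P K) a (β last) cofactor (R K) (α last) c (x ^ n - 1#)) ⟩
          R K * - (cofactor * (x ^ n - 1#)) * - (c * a)
            ≈⟨ *-congʳ (*-congˡ denFactor-last) ⟨
          R K * denFactor K * - (c * a) ∎)
        (L.Unit-* (unit-β last last<n) unit-cofactor)
        where
        open SetoidReasoning setoid
        K = s ℕ.+ last
        a = numFactor K

      inverse : ∀ k → Σ Carrier λ i → suc k ℕ.< n → denFactor (s ℕ.+ k) * i ~ 1#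
      inverse k with suc k ℕ.<? n
      ... | yes k<n = proj₁ (unit-denFactor k k<n) , λ _ → proj₂ (unit-denFactor k k<n)
      ... | no  k≮n = 0# , λ k<n → contradiction k<n k≮n

      -- The residue of α/β. It is built factor by factor because `τ-suc` needs the ratio of
      -- consecutive values.
      ρ : ℕ → Carrier
      ρ zero    = x₀ * proj₁ unit₀
      ρ (suc k) = ρ k * numFactor (s ℕ.+ k) * proj₁ (inverse k)

      ρ-ratio : ∀ k → k ℕ.< n → α k ~ ρ k * β k
      ρ-ratio zero _ = L.modulo (proj₂ unit₀) (- x₀)
        (I.solve 3 (λ x y i → x ⊜ x ⊠ i ⊠ y ⊞ I.:- x ⊠ (y ⊠ i ⊟ L.:1)) A.refl x₀ y₀ (proj₁ unit₀))
      ρ-ratio (suc k) k<n = L.modulo₂ (ρ-ratio k (ℕ.<-trans (ℕ.n<1+n k) k<n)) a (proj₂ (inverse k) k<n) (- (ρ k * β k * a))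
        (I.solve 6 (λ α β ρ a b i → α ⊠ a ⊜ ρ ⊠ a ⊠ i ⊠ (β ⊠ b) ⊞ a ⊠ (α ⊟ ρ ⊠ β) ⊞ I.:- (ρ ⊠ β ⊠ a) ⊠ (b ⊠ i ⊟ L.:1))
          A.refl (α k) (β k) (ρ k) a (denFactor (s ℕ.+ k)) (proj₁ (inverse k)))
        where a = numFactor (s ℕ.+ k)

      ε∣ρ : ∀ k → N ℕ.< k → k ℕ.< n → ε L.∣ ρ k
      ε∣ρ k N<k k<n with ∣⇒∣ᴬ (ε∣α k N<k) | unit-β k k<n
      ... | c L., cε | i , βi = c * i L., L.modulo₂ (A.trans cε (ρ-ratio k k<n)) i βi (ρ k)
        (I.solve 5 (λ c i ε ρ β → c ⊠ i ⊠ ε ⊜ ρ ⊞ i ⊠ (c ⊠ ε ⊟ ρ ⊠ β) ⊞ ρ ⊠ (β ⊠ i ⊟ L.:1)) A.refl c i ε (ρ k) (β k))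

      y : Carrier
      y = x L.^ (4 ℕ.* s)

      y≈₁1 : y ≈₁1
      y≈₁1 with ≈₁-^ (4 ℕ.* ℓ) θ≈₁1
      ... | c L., e = c L., A.trans e (A.+-congʳ (A.trans (L.^-assocʳ x n (4 ℕ.* ℓ)) (A.reflexive (≡.cong (x L.^_) n4ℓ))))
        where
        n4ℓ : n ℕ.* (4 ℕ.* ℓ) ≡ 4 ℕ.* s
        n4ℓ = solveℕ 2 (λ n ℓ → n ⊗ℕ (conℕ 4 ⊗ℕ ℓ) ⊜ℕ conℕ 4 ⊗ℕ (ℓ ⊗ℕ n)) ≡.refl n ℓ

      ζ : ℕ → Carrier
      ζ = z y y≈₁1

      x^~ζx^ : ∀ k r → x ^ (4 ℕ.* (s ℕ.+ k) ℕ.+ suc r) ~ ζ k * x L.^ r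
      x^~ζx^ k r = begin
        x ^ (4 ℕ.* (s ℕ.+ k) ℕ.+ suc r)            ≡⟨ ^ᴬ≡^ x (4 ℕ.* (s ℕ.+ k) ℕ.+ suc r) ⟨
        x L.^ (4 ℕ.* (s ℕ.+ k) ℕ.+ suc r)          ≡⟨ ≡.cong (x L.^_) (≡.trans (≡.cong (ℕ._+ suc r) (ℕ.*-distribˡ-+ 4 s k)) (ℕ.+-assoc (4 ℕ.* s) (4 ℕ.* k) (suc r))) ⟩
        x L.^ (4 ℕ.* s ℕ.+ (4 ℕ.* k ℕ.+ suc r))    ≈⟨ L.^-homo-* x (4 ℕ.* s) _ ⟩
        y * x L.^ (4 ℕ.* k ℕ.+ suc r)              ≈⟨ A.*-congˡ (q^4i+r k (suc r)) ⟩
        y * ((x L.^ 4) L.^ k * (x * x L.^ r))      ≈⟨ I.solve 4 (λ y a x b → y ⊠ (a ⊠ (x ⊠ b)) ⊜ y ⊠ (a ⊠ x ↑ 1) ⊠ b) A.refl y _ x _ ⟩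
        ζ k * x L.^ r                              ∎
        where open SetoidReasoning A.setoid

      numFactor~ : ∀ k → numFactor (s ℕ.+ k) ~ 1# - v y y≈₁1 k
      numFactor~ k = A.trans (≈⇒~ (numFactor≈ (s ℕ.+ k))) (A.+-congˡ (A.-‿cong (A.trans (x^~ζx^ k 1) (A.*-congˡ (A.*-identityʳ x)))))

      denFactor~ : ∀ k → denFactor (s ℕ.+ k) ~ 1# - u y y≈₁1 k
      denFactor~ k = A.trans (≈⇒~ (denFactor≈ (s ℕ.+ k))) (A.+-congˡ (A.-‿cong (x^~ζx^ k 3)))

      τ w : ℕ → Carrier
      τ k = x ^ (s ℕ.+ k) * ρ k L.^ 3 * proj₁ unit-1+x
      w k = (1# + ζ k) * τ k

      τ-suc : ∀ k → k ℕ.< N → τ (suc k) * (1# - u y y≈₁1 k) L.^ 3 ~ τ k * x * (1# - v y y≈₁1 k) L.^ 3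
      τ-suc k k<N rewrite ℕ.+-suc s k = begin
        x * ξ * (ρ k * a * i) L.^ 3 * j * (1# - u y y≈₁1 k) L.^ 3
          ≈⟨ A.*-congˡ (L.^-congˡ 3 (denFactor~ k)) ⟨
        x * ξ * (ρ k * a * i) L.^ 3 * j * b L.^ 3
          ≈⟨ I.solve 7 (λ x ξ ρ a i j b → x ⊠ ξ ⊠ (ρ ⊠ a ⊠ i) ↑ 3 ⊠ j ⊠ b ↑ 3 ⊜ ξ ⊠ ρ ↑ 3 ⊠ j ⊠ x ⊠ (a ⊠ (b ⊠ i)) ↑ 3) A.refl x ξ (ρ k) a i j b ⟩
        ξ * ρ k L.^ 3 * j * x * (a * (b * i)) L.^ 3
          ≈⟨ A.*-congˡ (L.^-congˡ 3 (A.trans (A.*-cong (numFactor~ k) (proj₂ (inverse k) 1+k<n)) (A.*-identityʳ _))) ⟩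
        ξ * ρ k L.^ 3 * j * x * (1# - v y y≈₁1 k) L.^ 3 ∎
        where
        open SetoidReasoning A.setoid
        ξ = x ^ (s ℕ.+ k)
        a = numFactor (s ℕ.+ k)
        b = denFactor (s ℕ.+ k)
        i = proj₁ (inverse k)
        j = proj₁ unit-1+x
        1+k<n : suc k ℕ.< n
        1+k<n = ℕ.≤-<-trans k<N (ℕ.<-trans N<last last<n)

      term-value : ∀ k → k ℕ.< n → Value (term′ (s ℕ.+ k)) (w k)
      term-value k k<n = value (f * α k ^ 3 * ξ) ((1# + x) * β k ^ 3)
        (begin
          f * P K ^ 3 * ξ * ((1# + x) * β k ^ 3)
            ≈⟨ solve 5 (λ f p x g β → f :* (p :* (p :* (p :* :1))) :* x :* (g :* β :^ 3) := f :* x :* g :* (p :* β) :^ 3) refl f (P K) ξ (1# + x) (β k) ⟩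
          f * ξ * (1# + x) * (P K * β k) ^ 3
            ≈⟨ *-congˡ (^-congˡ 3 (cross k)) ⟩
          f * ξ * (1# + x) * (R K * α k) ^ 3
            ≈⟨ solve 5 (λ f r x g α → f :* x :* g :* (r :* α) :^ 3 := g :* (r :* (r :* (r :* :1))) :* (f :* α :^ 3 :* x)) refl f (R K) ξ (1# + x) (α k) ⟩
          (1# + x) * R K ^ 3 * (f * α k ^ 3 * ξ) ∎)
        (L.Unit-* unit-1+x (≡.subst L.Unit (^ᴬ≡^ (β k) 3) (L.Unit-^ 3 (unit-β k k<n))))
        ratio
        where
        open SetoidReasoning setoid
        K = s ℕ.+ k
        ξ = x ^ K
        f = 1# + x ^ (4 ℕ.* K ℕ.+ 1)
        i = proj₁ unit-1+x
        f~ : f ~ 1# + ζ k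
        f~ = A.+-congˡ (A.trans (x^~ζx^ k 0) (A.*-identityʳ (ζ k)))
        ratio : f * α k L.^ 3 * ξ ~ w k * ((1# + x) * β k L.^ 3)
        ratio = A.trans (A.*-congʳ (A.*-cong f~ (L.^-congˡ 3 (ρ-ratio k k<n))))
          (L.modulo (proj₂ unit-1+x) (- ((1# + ζ k) * (ρ k * β k) L.^ 3 * ξ))
            (I.solve 6 (λ f ρ β x g i → f ⊠ (ρ ⊠ β) ↑ 3 ⊠ x ⊜ f ⊠ (x ⊠ ρ ↑ 3 ⊠ i) ⊠ (g ⊠ β ↑ 3)
                ⊞ I.:- (f ⊠ (ρ ⊠ β) ↑ 3 ⊠ x) ⊠ (g ⊠ i ⊟ L.:1)) A.refl (1# + ζ k) (ρ k) (β k) ξ (1# + x) i))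

      w-vanishes : ∀ k → N ℕ.< k → k ℕ.< n → w k ~ 0#
      w-vanishes k N<k k<n = cube-vanishes (1# + ζ k) (x ^ (s ℕ.+ k)) (ρ k) (proj₁ unit-1+x) (ε∣-*≈0 (ε∣ρ k N<k k<n) (ε∣ρ k N<k k<n))
        where
        cube-vanishes : ∀ f ξ ρ i → ρ * ρ ~ 0# → f * (ξ * ρ L.^ 3 * i) ~ 0#
        cube-vanishes f ξ ρ i ρρ = L.modulo ρρ (f * ξ * ρ * i)
          (I.solve 4 (λ f ξ ρ i → f ⊠ (ξ ⊠ ρ ↑ 3 ⊠ i) ⊜ I.con (+ 0) ⊞ f ⊠ ξ ⊠ ρ ⊠ i ⊠ (ρ ⊠ ρ ⊟ I.con (+ 0))) A.refl f ξ ρ i)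

      module _ (S-start : Value (S′ s) 0#) where
        partial : ∀ k → k ℕ.≤ n → Value (S′ (s ℕ.+ k)) (L.∑ w k)
        partial zero    _   = ≡.subst (λ i → Value (S′ i) 0#) (≡.sym (ℕ.+-identityʳ s)) S-start
        partial (suc k) k<n = ≡.subst (λ i → Value (S′ i) (L.∑ w (suc k))) (≡.sym (ℕ.+-suc s k))
          (Value-+ (partial k (ℕ.<⇒≤ k<n)) (term-value k k<n))

        -- Every cut beyond `N` gives zero: k = n closes the block for the induction, and k = N + 1
        -- is the cut of the second congruence.
        S-vanishes : ∀ k → N ℕ.< k → k ℕ.≤ n → Value (S′ (s ℕ.+ k)) 0#
        S-vanishes k N<k k≤n = Value-resp (L.∑-tail w (block-sum y y≈₁1 τ τ-suc) N<k
          λ i N<i i<k → w-vanishes i N<i (ℕ.<-≤-trans i<k k≤n)) (partial k k≤n)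

    -- Regularity is carried along because each block starts from the reduced fraction left by the
    -- one before.
    at-multiple : ∀ ℓ → Regular (ℓ ℕ.* n) × Value (S′ (ℓ ℕ.* n)) 0#
    at-multiple zero    = regular 1# 1# refl L.Unit-1 , Value-zero
    at-multiple (suc ℓ) = ≡.subst (λ i → Regular i × Value (S′ i) 0#) (ℕ.+-comm (ℓ ℕ.* n) n)
      (next ℓ r , S-vanishes ℓ r val n (ℕ.<-trans (N<last ℓ r) (last<n ℓ r)) ℕ.≤-refl)
      where
      r = proj₁ (at-multiple ℓ)
      val = proj₂ (at-multiple ℓ)

    supercongruence : ∀ m → Divisible (S′ (m ℕ.* n)) × Divisible (S′ (m ℕ.* n ℕ.+ suc N))
    supercongruence m = Value-0⇒Divisible val , Value-0⇒Divisible
      (S-vanishes m r val (suc N) ℕ.≤-refl (ℕ.<⇒≤ (ℕ.≤-<-trans (N<last m r) (last<n m r))))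
      where
      r = proj₁ (at-multiple m)
      val = proj₂ (at-multiple m)

-- Polynomials over ℚ

-- A record, unlike _≈P_, lets Agda recover the two polynomials from the type.
infix 4 _≋_
record _≋_ (p r : Poly) : Set where
  constructor coeffwise
  field coeffs : p ≈P r
open _≋_

≋-isEquivalence : IsEquivalence _≋_
≋-isEquivalence = record
  { refl  = coeffwise λ i → ≡.refl
  ; sym   = λ e → coeffwise λ i → ≡.sym (coeffs e i)
  ; trans = λ e f → coeffwise λ i → ≡.trans (coeffs e i) (coeffs f i)
  }

open IsEquivalence ≋-isEquivalence using () renaming (refl to ≋-refl; sym to ≋-sym; trans to ≋-trans)

≋-setoid : Setoid 0ℓ 0ℓ
≋-setoid = record { isEquivalence = ≋-isEquivalence }

coeff-⊕ : ∀ p r i → coeff (p ⊕ r) i ≡ coeff p i ℚ.+ coeff r i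
coeff-⊕ []      r       i       = ≡.sym (ℚ.+-identityˡ _)
coeff-⊕ (a ∷ p) []      zero    = ≡.sym (ℚ.+-identityʳ _)
coeff-⊕ (a ∷ p) []      (suc i) = ≡.sym (ℚ.+-identityʳ _)
coeff-⊕ (a ∷ p) (b ∷ r) zero    = ≡.refl
coeff-⊕ (a ∷ p) (b ∷ r) (suc i) = coeff-⊕ p r i

coeff-scale : ∀ c p i → coeff (scale c p) i ≡ c ℚ.* coeff p i
coeff-scale c []      i       = ≡.sym (ℚ.*-zeroʳ c)
coeff-scale c (a ∷ p) zero    = ≡.refl
coeff-scale c (a ∷ p) (suc i) = coeff-scale c p i

coeff-neg : ∀ p i → coeff (negP p) i ≡ ℚ.- coeff p i
coeff-neg p i = ≡.trans (coeff-scale (ℚ.- 1ℚ) p i)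
  (≡.trans (≡.sym (ℚ.neg-distribˡ-* 1ℚ (coeff p i))) (≡.cong ℚ.-_ (ℚ.*-identityˡ (coeff p i))))

⊕-cong : ∀ {p p′ r r′} → p ≋ p′ → r ≋ r′ → p ⊕ r ≋ p′ ⊕ r′
⊕-cong {p} {p′} {r} {r′} e f = coeffwise λ i → ≡.trans (coeff-⊕ p r i)
  (≡.trans (≡.cong₂ ℚ._+_ (coeffs e i) (coeffs f i)) (≡.sym (coeff-⊕ p′ r′ i)))

⊕-assoc : ∀ p r s → (p ⊕ r) ⊕ s ≋ p ⊕ (r ⊕ s)
⊕-assoc p r s = coeffwise λ i → begin
  coeff ((p ⊕ r) ⊕ s) i                    ≡⟨ coeff-⊕ (p ⊕ r) s i ⟩
  coeff (p ⊕ r) i ℚ.+ coeff s i            ≡⟨ ≡.cong (ℚ._+ coeff s i) (coeff-⊕ p r i) ⟩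
  coeff p i ℚ.+ coeff r i ℚ.+ coeff s i    ≡⟨ ℚ.+-assoc (coeff p i) (coeff r i) (coeff s i) ⟩
  coeff p i ℚ.+ (coeff r i ℚ.+ coeff s i)  ≡⟨ ≡.cong (coeff p i ℚ.+_) (coeff-⊕ r s i) ⟨
  coeff p i ℚ.+ coeff (r ⊕ s) i            ≡⟨ coeff-⊕ p (r ⊕ s) i ⟨
  coeff (p ⊕ (r ⊕ s)) i                    ∎
  where open ≡.≡-Reasoning

⊕-comm : ∀ p r → p ⊕ r ≋ r ⊕ p
⊕-comm p r = coeffwise λ i → ≡.trans (coeff-⊕ p r i)
  (≡.trans (ℚ.+-comm (coeff p i) (coeff r i)) (≡.sym (coeff-⊕ r p i)))

⊕-identityʳ : ∀ p → p ⊕ [] ≋ p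
⊕-identityʳ p = ⊕-comm p []

⊕-inverseʳ : ∀ p → p ⊕ negP p ≋ []
⊕-inverseʳ p = coeffwise λ i → ≡.trans (coeff-⊕ p (negP p) i)
  (≡.trans (≡.cong (coeff p i ℚ.+_) (coeff-neg p i)) (ℚ.+-inverseʳ (coeff p i)))

negP-cong : ∀ {p r} → p ≋ r → negP p ≋ negP r
negP-cong {p} {r} e = coeffwise λ i → ≡.trans (coeff-neg p i) (≡.trans (≡.cong ℚ.-_ (coeffs e i)) (≡.sym (coeff-neg r i)))

⊕-isAbelianGroup : IsAbelianGroup _≋_ _⊕_ [] negP
⊕-isAbelianGroup = record
  { isGroup = record
    { isMonoid = record
      { isSemigroup = record
        { isMagma = record { isEquivalence = ≋-isEquivalence ; ∙-cong = ⊕-cong }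
        ; assoc = ⊕-assoc }
      ; identity = (λ p → ≋-refl) , ⊕-identityʳ }
    ; inverse = (λ p → ≋-trans (⊕-comm (negP p) p) (⊕-inverseʳ p)) , ⊕-inverseʳ
    ; ⁻¹-cong = negP-cong }
  ; comm = ⊕-comm }

⊕-abelianGroup : AbelianGroup 0ℓ 0ℓ
⊕-abelianGroup = record { isAbelianGroup = ⊕-isAbelianGroup }

open import Algebra.Properties.CommutativeSemigroup (AbelianGroup.commutativeSemigroup ⊕-abelianGroup)
  using () renaming (interchange to ⊕-interchange; x∙yz≈y∙xz to ⊕-swap)

∷-cong : ∀ {a b p r} → a ≡ b → p ≋ r → a ∷ p ≋ b ∷ r
∷-cong a≡b e = coeffwise λ { zero → a≡b ; (suc i) → coeffs e i }

scale-cong : ∀ {a b p r} → a ≡ b → p ≋ r → scale a p ≋ scale b r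
scale-cong {a} {b} {p} {r} a≡b e = coeffwise λ i → ≡.trans (coeff-scale a p i)
  (≡.trans (≡.cong₂ ℚ._*_ a≡b (coeffs e i)) (≡.sym (coeff-scale b r i)))

scale-⊕ : ∀ a p r → scale a (p ⊕ r) ≋ scale a p ⊕ scale a r
scale-⊕ a p r = coeffwise λ i → begin
  coeff (scale a (p ⊕ r)) i                      ≡⟨ coeff-scale a (p ⊕ r) i ⟩
  a ℚ.* coeff (p ⊕ r) i                          ≡⟨ ≡.cong (a ℚ.*_) (coeff-⊕ p r i) ⟩
  a ℚ.* (coeff p i ℚ.+ coeff r i)                ≡⟨ ℚ.*-distribˡ-+ a (coeff p i) (coeff r i) ⟩
  a ℚ.* coeff p i ℚ.+ a ℚ.* coeff r i            ≡⟨ ≡.cong₂ ℚ._+_ (coeff-scale a p i) (coeff-scale a r i) ⟨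
  coeff (scale a p) i ℚ.+ coeff (scale a r) i    ≡⟨ coeff-⊕ (scale a p) (scale a r) i ⟨
  coeff (scale a p ⊕ scale a r) i                ∎
  where open ≡.≡-Reasoning

scale-+ : ∀ a b p → scale (a ℚ.+ b) p ≋ scale a p ⊕ scale b p
scale-+ a b p = coeffwise λ i → begin
  coeff (scale (a ℚ.+ b) p) i                    ≡⟨ coeff-scale (a ℚ.+ b) p i ⟩
  (a ℚ.+ b) ℚ.* coeff p i                        ≡⟨ ℚ.*-distribʳ-+ (coeff p i) a b ⟩
  a ℚ.* coeff p i ℚ.+ b ℚ.* coeff p i            ≡⟨ ≡.cong₂ ℚ._+_ (coeff-scale a p i) (coeff-scale b p i) ⟨
  coeff (scale a p) i ℚ.+ coeff (scale b p) i    ≡⟨ coeff-⊕ (scale a p) (scale b p) i ⟨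
  coeff (scale a p ⊕ scale b p) i                ∎
  where open ≡.≡-Reasoning

scale-* : ∀ a b p → scale (a ℚ.* b) p ≋ scale a (scale b p)
scale-* a b p = coeffwise λ i → begin
  coeff (scale (a ℚ.* b) p) i     ≡⟨ coeff-scale (a ℚ.* b) p i ⟩
  a ℚ.* b ℚ.* coeff p i           ≡⟨ ℚ.*-assoc a b (coeff p i) ⟩
  a ℚ.* (b ℚ.* coeff p i)         ≡⟨ ≡.cong (a ℚ.*_) (coeff-scale b p i) ⟨
  a ℚ.* coeff (scale b p) i       ≡⟨ coeff-scale a (scale b p) i ⟨
  coeff (scale a (scale b p)) i   ∎
  where open ≡.≡-Reasoning

scale-1 : ∀ p → scale 1ℚ p ≋ p
scale-1 p = coeffwise λ i → ≡.trans (coeff-scale 1ℚ p i) (ℚ.*-identityˡ (coeff p i))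

scale-0 : ∀ p → scale 0ℚ p ≋ []
scale-0 p = coeffwise λ i → ≡.trans (coeff-scale 0ℚ p i) (ℚ.*-zeroˡ (coeff p i))

0∷[]≋[] : 0ℚ ∷ [] ≋ []
0∷[]≋[] = coeffwise λ { zero → ≡.refl ; (suc i) → ≡.refl }

head-≋[] : ∀ {a p} → a ∷ p ≋ [] → a ≡ 0ℚ
head-≋[] e = coeffs e 0

tail-≋[] : ∀ {a p} → a ∷ p ≋ [] → p ≋ []
tail-≋[] e = coeffwise λ i → coeffs e (suc i)

tail-≋ : ∀ {a b p r} → a ∷ p ≋ b ∷ r → p ≋ r
tail-≋ e = coeffwise λ i → coeffs e (suc i)

⊕-≋[] : ∀ {p r} → p ≋ [] → r ≋ [] → p ⊕ r ≋ []
⊕-≋[] e f = ⊕-cong e f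

≋[]-⊗ : ∀ p r → p ≋ [] → p ⊗ r ≋ []
≋[]-⊗ []      r e = ≋-refl
≋[]-⊗ (a ∷ p) r e = ⊕-≋[] (≋-trans (scale-cong (head-≋[] e) ≋-refl) (scale-0 r))
  (≋-trans (∷-cong ≡.refl (≋[]-⊗ p r (tail-≋[] e))) 0∷[]≋[])

⊗-congʳ : ∀ p p′ r → p ≋ p′ → p ⊗ r ≋ p′ ⊗ r
⊗-congʳ []      p′       r e = ≋-sym (≋[]-⊗ p′ r (≋-sym e))
⊗-congʳ (a ∷ p) []       r e = ≋[]-⊗ (a ∷ p) r e
⊗-congʳ (a ∷ p) (b ∷ p′) r e = ⊕-cong (scale-cong (coeffs e 0) ≋-refl) (∷-cong ≡.refl (⊗-congʳ p p′ r (tail-≋ e)))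

⊗-congˡ : ∀ p {r r′} → r ≋ r′ → p ⊗ r ≋ p ⊗ r′
⊗-congˡ []      e = ≋-refl
⊗-congˡ (a ∷ p) e = ⊕-cong (scale-cong {a} ≡.refl e) (∷-cong ≡.refl (⊗-congˡ p e))

⊗-distribʳ : ∀ r p p′ → (p ⊕ p′) ⊗ r ≋ p ⊗ r ⊕ p′ ⊗ r
⊗-distribʳ r []      p′       = ≋-refl
⊗-distribʳ r (a ∷ p) []       = ≋-sym (⊕-identityʳ _)
⊗-distribʳ r (a ∷ p) (b ∷ p′) = ≋-trans
  (⊕-cong (scale-+ a b r) (∷-cong (≡.sym (ℚ.+-identityˡ 0ℚ)) (⊗-distribʳ r p p′)))
  (⊕-interchange (scale a r) (scale b r) (0ℚ ∷ p ⊗ r) (0ℚ ∷ p′ ⊗ r))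

⊗-zeroʳ : ∀ p → p ⊗ [] ≋ []
⊗-zeroʳ []      = ≋-refl
⊗-zeroʳ (a ∷ p) = ≋-trans (∷-cong ≡.refl (⊗-zeroʳ p)) 0∷[]≋[]

⊗-∷ : ∀ p b r → p ⊗ (b ∷ r) ≋ scale b p ⊕ (0ℚ ∷ p ⊗ r)
⊗-∷ []      b r = ≋-sym 0∷[]≋[]
⊗-∷ (a ∷ p) b r = ∷-cong (≡.cong (ℚ._+ 0ℚ) (ℚ.*-comm a b))
  (≋-trans (⊕-cong ≋-refl (⊗-∷ p b r)) (⊕-swap (scale a r) (scale b p) (0ℚ ∷ p ⊗ r)))

⊗-comm : ∀ p r → p ⊗ r ≋ r ⊗ p
⊗-comm []      r = ≋-sym (⊗-zeroʳ r)
⊗-comm (a ∷ p) r = ≋-trans (⊕-cong ≋-refl (∷-cong ≡.refl (⊗-comm p r))) (≋-sym (⊗-∷ r a p))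

scale-⊗ : ∀ a p r → scale a p ⊗ r ≋ scale a (p ⊗ r)
scale-⊗ a []      r = ≋-refl
scale-⊗ a (b ∷ p) r = ≋-sym (≋-trans (scale-⊕ a (scale b r) (0ℚ ∷ p ⊗ r))
  (⊕-cong (≋-sym (scale-* a b r)) (∷-cong (ℚ.*-zeroʳ a) (≋-sym (scale-⊗ a p r)))))

0∷-⊗ : ∀ p r → (0ℚ ∷ p) ⊗ r ≋ 0ℚ ∷ p ⊗ r
0∷-⊗ p r = ⊕-cong (scale-0 r) ≋-refl

⊗-assoc : ∀ p r s → (p ⊗ r) ⊗ s ≋ p ⊗ (r ⊗ s)
⊗-assoc []      r s = ≋-refl
⊗-assoc (a ∷ p) r s = begin
  (scale a r ⊕ (0ℚ ∷ p ⊗ r)) ⊗ s          ≈⟨ ⊗-distribʳ s (scale a r) (0ℚ ∷ p ⊗ r) ⟩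
  scale a r ⊗ s ⊕ (0ℚ ∷ p ⊗ r) ⊗ s        ≈⟨ ⊕-cong (scale-⊗ a r s) (0∷-⊗ (p ⊗ r) s) ⟩
  scale a (r ⊗ s) ⊕ (0ℚ ∷ (p ⊗ r) ⊗ s)    ≈⟨ ⊕-cong ≋-refl (∷-cong ≡.refl (⊗-assoc p r s)) ⟩
  scale a (r ⊗ s) ⊕ (0ℚ ∷ p ⊗ (r ⊗ s))    ∎
  where open SetoidReasoning ≋-setoid

⊗-identityˡ : ∀ p → oneP ⊗ p ≋ p
⊗-identityˡ p = ≋-trans (⊕-cong (scale-1 p) 0∷[]≋[]) (⊕-identityʳ p)

ℚ[X] : CommutativeRing 0ℓ 0ℓ
ℚ[X] = record
  { Carrier = Poly ; _≈_ = _≋_ ; _+_ = _⊕_ ; _*_ = _⊗_ ; -_ = negP ; 0# = [] ; 1# = oneP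
  ; isCommutativeRing = record
    { isRing = record
      { +-isAbelianGroup = ⊕-isAbelianGroup
      ; *-cong = λ {p} {p′} {r} {r′} e f → ≋-trans (⊗-congʳ p p′ r e) (⊗-congˡ p′ f)
      ; *-assoc = ⊗-assoc
      ; *-identity = ⊗-identityˡ , (λ p → ≋-trans (⊗-comm p oneP) (⊗-identityˡ p))
      ; distrib = (λ p r s → ≋-trans (⊗-comm p (r ⊕ s)) (≋-trans (⊗-distribʳ p r s) (⊕-cong (⊗-comm r p) (⊗-comm s p)))) , ⊗-distribʳ
      }
    ; *-comm = ⊗-comm
    }
  }

open RingLemmas ℚ[X]
open Comaximality ℚ[X]
open IntegerSolver ℚ[X] using (solve; _:=_; _:+_; _:*_; _:-_; :-_; con)
open SetoidReasoning (CommutativeRing.setoid ℚ[X])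

-- Leading coefficients and exact division by a monic polynomial.

Top : ℕ → ℚ → Poly → Set
Top D a p = coeff p D ≡ a × (∀ i → D ℕ.< i → coeff p i ≡ 0ℚ)

Top-resp : ∀ {D a p r} → p ≋ r → Top D a p → Top D a r
Top-resp e (top , above) = ≡.trans (≡.sym (coeffs e _)) top , λ i D<i → ≡.trans (≡.sym (coeffs e i)) (above i D<i)

Top-∷ : ∀ {D a b p} → Top D a p → Top (suc D) a (b ∷ p)
Top-∷ (top , above) = top , λ { (suc i) (ℕ.s≤s D<i) → above i D<i }

Top-≋[] : ∀ {D a p} → p ≋ [] → Top D a p → a ≡ 0ℚ
Top-≋[] e (top , _) = ≡.trans (≡.sym top) (coeffs e _)

Top-⊗ : ∀ {D E a b} p r → Top D a p → Top E b r → Top (D ℕ.+ E) (a ℚ.* b) (p ⊗ r)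
Top-⊗ {b = b} [] r (top , _) _ =
  ≡.trans (≡.sym (ℚ.*-zeroˡ b)) (≡.cong (ℚ._* b) top) , λ _ _ → ≡.refl
Top-⊗ {zero} {E} {a} {b} (c ∷ p) r (top , above) (topr , abover) = Top-resp (≋-sym constant)
  ( ≡.trans (coeff-scale c r E) (≡.cong₂ ℚ._*_ top topr)
  , λ i E<i → ≡.trans (coeff-scale c r i) (≡.trans (≡.cong (c ℚ.*_) (abover i E<i)) (ℚ.*-zeroʳ c)))
  where
  constant : (c ∷ p) ⊗ r ≋ scale c r
  constant = ≋-trans (⊕-cong ≋-refl (≋-trans (∷-cong ≡.refl (≋[]-⊗ p r (coeffwise λ i → above (suc i) (ℕ.s≤s ℕ.z≤n)))) 0∷[]≋[]))
    (⊕-identityʳ (scale c r))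
Top-⊗ {suc D} {E} {a} {b} (c ∷ p) r (top , above) (topr , abover) =
  ≡.trans (coeff-sum (suc (D ℕ.+ E)) (ℕ.s≤s (ℕ.m≤n+m E D))) (proj₁ rec)
  , λ { (suc i) (ℕ.s≤s D+E<i) → ≡.trans (coeff-sum (suc i) (ℕ.<-trans (ℕ.s≤s (ℕ.m≤n+m E D)) (ℕ.s≤s D+E<i))) (proj₂ rec i D+E<i) }
  where
  rec : Top (D ℕ.+ E) (a ℚ.* b) (p ⊗ r)
  rec = Top-⊗ p r (top , λ i D<i → above (suc i) (ℕ.s≤s D<i)) (topr , abover)
  coeff-sum : ∀ i → E ℕ.< i → coeff ((c ∷ p) ⊗ r) i ≡ coeff (0ℚ ∷ p ⊗ r) i
  coeff-sum i E<i = ≡.trans (coeff-⊕ (scale c r) (0ℚ ∷ p ⊗ r) i)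
    (≡.trans (≡.cong (ℚ._+ coeff (0ℚ ∷ p ⊗ r) i)
      (≡.trans (coeff-scale c r i) (≡.trans (≡.cong (c ℚ.*_) (abover i E<i)) (ℚ.*-zeroʳ c))))
      (ℚ.+-identityˡ _))

data Leading (p : Poly) : Set where
  vanishing : p ≋ [] → Leading p
  leading   : ∀ D a → a ≢ 0ℚ → Top D a p → Leading p

leading? : ∀ p → Leading p
leading? [] = vanishing ≋-refl
leading? (a ∷ p) with leading? p
... | leading D b b≢0 top = leading (suc D) b b≢0 (Top-∷ top)
... | vanishing e with a ℚ.≟ 0ℚ
...   | yes a≡0 = vanishing (≋-trans (∷-cong a≡0 e) 0∷[]≋[])
...   | no  a≢0 = leading 0 a a≢0 (≡.refl , λ { (suc i) _ → coeffs e i })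

Monic : Poly → Set
Monic p = Σ ℕ λ D → Top D 1ℚ p

1≢0 : 1ℚ ≢ 0ℚ
1≢0 ()

Monic-⊗ : ∀ {p r} → Monic p → Monic r → Monic (p ⊗ r)
Monic-⊗ {p} {r} (D , s) (E , t) = D ℕ.+ E , Top-⊗ p r s t

Top-monic-⊗ : ∀ {D E a} d p → Top D 1ℚ d → Top E a p → Top (D ℕ.+ E) a (d ⊗ p)
Top-monic-⊗ {a = a} d p s t = ≡.subst (λ b → Top _ b (d ⊗ p)) (ℚ.*-identityˡ a) (Top-⊗ d p s t)

Top-unique : ∀ {D E a b p} → a ≢ 0ℚ → b ≢ 0ℚ → Top D a p → Top E b p → D ≡ E × a ≡ b
Top-unique {D} {E} a≢0 b≢0 (top , above) (top′ , above′) with ℕ.<-cmp D E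
... | tri< D<E _ _ = contradiction (≡.trans (≡.sym top′) (above E D<E)) b≢0
... | tri> _ _ E<D = contradiction (≡.trans (≡.sym top) (above′ D E<D)) a≢0
... | tri≈ _ ≡.refl _ = ≡.refl , ≡.trans (≡.sym top) top′

Monic-cancel : ∀ d p → Monic d → Monic (d ⊗ p) → Monic p
Monic-cancel d p (D , s) (M , t) with leading? p
... | vanishing e = contradiction (Top-≋[] (≋-trans (⊗-congˡ d e) (⊗-zeroʳ d)) t) 1≢0
... | leading E a a≢0 u = E , ≡.subst (λ b → Top E b p) (≡.sym (proj₂ (Top-unique {p = d ⊗ p} 1≢0 a≢0 t (Top-monic-⊗ d p s u)))) u

Top-mono : ∀ k a → Top k a (mono k a)
Top-mono zero    a = ≡.refl , λ { (suc i) _ → ≡.refl }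
Top-mono (suc k) a = Top-∷ (Top-mono k a)

dropZeros : Poly → Poly
dropZeros = dropWhile (λ x → x ℚ.≟ 0ℚ)

-- `strip` works on the reversed list, where a new head sits at the end; `dropWhile` gets to it only
-- if everything before it is zero.
dropZeros-++ : ∀ p a → (dropZeros p ≡ [] × dropZeros (p ++ [ a ]) ≡ dropZeros [ a ])
                     ⊎ (dropZeros p ≢ [] × dropZeros (p ++ [ a ]) ≡ dropZeros p ++ [ a ])
dropZeros-++ [] a = inj₁ (≡.refl , ≡.refl)
dropZeros-++ (b ∷ p) a with b ℚ.≟ 0ℚ
... | yes _ = dropZeros-++ p a
... | no  _ = inj₂ ((λ ()) , ≡.refl)

-- Indexed by the output of `strip`, so that matching yields the length and last entry that
-- `divMonicF` inspects.
data Stripped (p : Poly) : Poly → Set where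
  vanishing : p ≋ [] → Stripped p []
  leading   : ∀ {s} D a → a ≢ 0ℚ → Top D a p → length s ≡ suc D → lastOr s ≡ a → s ≋ p → Stripped p s

stripped : ∀ p → Stripped p (strip p)
stripped [] = vanishing ≋-refl
stripped (a ∷ p) rewrite List.unfold-reverse a p with stripped p | dropZeros-++ (reverse p) a
... | st | inj₁ (empty , eq) rewrite eq | empty = single st
  where
  single : Stripped p [] → Stripped (a ∷ p) (reverse (dropZeros [ a ]))
  single (vanishing e) with a ℚ.≟ 0ℚ
  ... | yes a≡0 = vanishing (≋-trans (∷-cong a≡0 e) 0∷[]≋[])
  ... | no  a≢0 = leading 0 a a≢0 (≡.refl , λ { (suc i) _ → coeffs e i }) ≡.refl ≡.refl (∷-cong ≡.refl (≋-sym e))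
... | st | inj₂ (nonempty , eq) rewrite eq | List.reverse-++ (dropZeros (reverse p)) [ a ] = extend st strip≢[]
  where
  strip≢[] : strip p ≢ []
  strip≢[] e = nonempty (≡.trans (≡.sym (List.reverse-involutive _)) (≡.cong reverse e))
  extend : ∀ {s} → Stripped p s → s ≢ [] → Stripped (a ∷ p) (a ∷ s)
  extend (vanishing _) s≢[] = contradiction ≡.refl s≢[]
  extend {[]} (leading D b b≢0 top len last e) s≢[] = contradiction ≡.refl s≢[]
  extend {_ ∷ _} (leading D b b≢0 top len last e) _ = leading (suc D) b b≢0 (Top-∷ top) (≡.cong suc len) last (∷-cong ≡.refl e)

-- `g` bounds the length, and each step cancels the leading coefficient and so lowers the bound. The
-- remainder stays a multiple of `d`, hence the loop can only stop at zero.
divMonicF-exact : ∀ g p d → Monic d → d ∣ p → (∀ i → g ℕ.≤ i → coeff p i ≡ 0ℚ) →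
                  divMonicF (suc g) p d ⊗ d ≋ p
divMonicF-exact g p d (D , topd) (e , ed≋p) bound
  with strip p | stripped p | strip d | stripped d
... | _ | _ | _ | vanishing d≋[] = contradiction (Top-≋[] d≋[] topd) 1≢0
... | _ | vanishing p≋[] | d′ | leading D′ _ _ _ lend _ _ rewrite lend = ≋-sym p≋[]
... | p′ | leading L c c≢0 top len last p′≋p | d′ | leading D′ b b≢0 topd′ lend _ d′≋d
  with Top-unique {p = d} 1≢0 b≢0 topd topd′
... | ≡.refl , ≡.refl rewrite len | lend | last with L <ᵇ D in L<?D
-- A nonzero multiple of `d` cannot have degree below `D`.
... | true = contradiction (leading? e) λ
  { (vanishing e≋[]) → c≢0 (Top-≋[] (≋-trans (≋-sym ed≋p) (≋[]-⊗ e d e≋[])) top)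
  ; (leading E a a≢0 tope) → a≢0 (≡.trans (≡.sym (proj₁ (product tope)))
      (proj₂ top (D ℕ.+ E) (ℕ.<-≤-trans L<D (ℕ.m≤m+n D E)))) }
  where
  L<D : L ℕ.< D
  L<D = ℕ.<ᵇ⇒< L D (≡.subst T (≡.sym L<?D) tt)
  product : ∀ {E a} → Top E a e → Top (D ℕ.+ E) a p
  product tope = Top-resp (≋-trans (⊗-comm d e) ed≋p) (Top-monic-⊗ d e topd tope)
... | false = exact g bound
  where
  D≤L : D ℕ.≤ L
  D≤L = ℕ.≮⇒≥ λ L<D → ≡.subst T L<?D (ℕ.<⇒<ᵇ L<D)
  t p₂ : Poly
  t = mono (L ∸ D) c
  p₂ = p′ ⊕ negP (t ⊗ d′)
  topt : Top L c (t ⊗ d′)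
  topt = ≡.subst₂ (λ i a → Top i a (t ⊗ d′)) (ℕ.m∸n+n≡m D≤L) (ℚ.*-identityʳ c) (Top-⊗ t d′ (Top-mono (L ∸ D) c) (Top-resp (≋-sym d′≋d) topd))
  p₂≋ : p₂ ≋ p ⊕ negP (t ⊗ d)
  p₂≋ = ⊕-cong p′≋p (negP-cong (⊗-congˡ t d′≋d))
  coeff-p₂ : ∀ i → coeff p₂ i ≡ coeff p i ℚ.- coeff (t ⊗ d′) i
  coeff-p₂ i = ≡.trans (coeff-⊕ p′ (negP (t ⊗ d′)) i) (≡.cong₂ ℚ._+_ (coeffs p′≋p i) (coeff-neg (t ⊗ d′) i))
  bound₂ : ∀ i → L ℕ.≤ i → coeff p₂ i ≡ 0ℚ
  bound₂ i L≤i with ℕ.m≤n⇒m<n∨m≡n L≤i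
  ... | inj₁ L<i    = ≡.trans (coeff-p₂ i) (≡.cong₂ ℚ._-_ (proj₂ top i L<i) (proj₂ topt i L<i))
  ... | inj₂ ≡.refl = ≡.trans (coeff-p₂ L) (≡.trans (≡.cong₂ ℚ._-_ (proj₁ top) (proj₁ topt)) (ℚ.+-inverseʳ c))
  divides : d ∣ p₂
  divides = e ⊕ negP t , ≋-trans (solve 3 (λ e t d → (e :- t) :* d := e :* d :- t :* d) ≋-refl e t d)
    (≋-trans (⊕-cong ed≋p ≋-refl) (≋-sym p₂≋))
  exact : ∀ g → (∀ i → g ℕ.≤ i → coeff p i ≡ 0ℚ) → (t ⊕ divMonicF g p₂ d) ⊗ d ≋ p
  exact zero    bound = contradiction (≡.trans (≡.sym (proj₁ top)) (bound L ℕ.z≤n)) c≢0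
  exact (suc g) bound = ≋-trans (⊗-distribʳ d t (divMonicF (suc g) p₂ d))
    (≋-trans (⊕-cong (≋-refl {t ⊗ d}) (≋-trans (divMonicF-exact g p₂ d (D , topd) divides λ i g≤i → bound₂ i (ℕ.≤-trans L≤g g≤i)) p₂≋))
      (solve 2 (λ a b → a :+ (b :- a) := b) ≋-refl (t ⊗ d) p))
    where
    L≤g : L ℕ.≤ g
    L≤g = ℕ.≮⇒≥ λ g<L → c≢0 (≡.trans (≡.sym (proj₁ top)) (bound L g<L))

coeff-length : ∀ p i → length p ℕ.≤ i → coeff p i ≡ 0ℚ
coeff-length []      i       _             = ≡.refl
coeff-length (a ∷ p) (suc i) (ℕ.s≤s len≤i) = coeff-length p i len≤i

divMonic-exact : ∀ p d → Monic d → d ∣ p → divMonic p d ⊗ d ≋ p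
divMonic-exact p d monic d∣p = divMonicF-exact (length p) p d monic d∣p (coeff-length p)

-- Cyclotomic polynomials

^P≡^ : ∀ p k → p ^P k ≡ p ^ k
^P≡^ p zero    = ≡.refl
^P≡^ p (suc k) = ≡.cong (p ⊗_) (^P≡^ p k)

-- The formal derivative, from (a + Xp)' = p + Xp'; it serves to show that X^N - 1 is separable.
∂ : Poly → Poly
∂ []      = []
∂ (a ∷ p) = p ⊕ (0ℚ ∷ ∂ p)

∂-≋[] : ∀ p → p ≋ [] → ∂ p ≋ []
∂-≋[] []      e = ≋-refl
∂-≋[] (a ∷ p) e = ⊕-≋[] (tail-≋[] e) (≋-trans (∷-cong ≡.refl (∂-≋[] p (tail-≋[] e))) 0∷[]≋[])

∂-cong : ∀ p r → p ≋ r → ∂ p ≋ ∂ r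
∂-cong []      r       e = ≋-sym (∂-≋[] r (≋-sym e))
∂-cong (a ∷ p) []      e = ∂-≋[] (a ∷ p) e
∂-cong (a ∷ p) (b ∷ r) e = ⊕-cong (tail-≋ e) (∷-cong ≡.refl (∂-cong p r (tail-≋ e)))

∂-⊕ : ∀ p r → ∂ (p ⊕ r) ≋ ∂ p ⊕ ∂ r
∂-⊕ []      r       = ≋-refl
∂-⊕ (a ∷ p) []      = ≋-sym (⊕-identityʳ _)
∂-⊕ (a ∷ p) (b ∷ r) = ≋-trans (⊕-cong (≋-refl {p ⊕ r}) (∷-cong (≡.sym (ℚ.+-identityˡ 0ℚ)) (∂-⊕ p r)))
  (⊕-interchange p r (0ℚ ∷ ∂ p) (0ℚ ∷ ∂ r))

∂-scale : ∀ a p → ∂ (scale a p) ≋ scale a (∂ p)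
∂-scale a []      = ≋-refl
∂-scale a (b ∷ p) = ≋-trans (⊕-cong ≋-refl (∷-cong (≡.sym (ℚ.*-zeroʳ a)) (∂-scale a p))) (≋-sym (scale-⊕ a p (0ℚ ∷ ∂ p)))

∂-⊗ : ∀ p r → ∂ (p ⊗ r) ≋ ∂ p ⊗ r ⊕ p ⊗ ∂ r
∂-⊗ []      r = ≋-refl
∂-⊗ (a ∷ p) r = begin
  ∂ (scale a r ⊕ (0ℚ ∷ p ⊗ r))
    ≈⟨ ∂-⊕ (scale a r) (0ℚ ∷ p ⊗ r) ⟩
  ∂ (scale a r) ⊕ (p ⊗ r ⊕ (0ℚ ∷ ∂ (p ⊗ r)))
    ≈⟨ ⊕-cong (∂-scale a r) (⊕-cong (≋-refl {p ⊗ r}) (∷-cong (≡.sym (ℚ.+-identityˡ 0ℚ)) (∂-⊗ p r))) ⟩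
  scale a (∂ r) ⊕ (p ⊗ r ⊕ ((0ℚ ∷ ∂ p ⊗ r) ⊕ (0ℚ ∷ p ⊗ ∂ r)))
    ≈⟨ solve 4 (λ a b c d → a :+ (b :+ (c :+ d)) := b :+ c :+ (a :+ d)) ≋-refl
         (scale a (∂ r)) (p ⊗ r) (0ℚ ∷ ∂ p ⊗ r) (0ℚ ∷ p ⊗ ∂ r) ⟩
  p ⊗ r ⊕ (0ℚ ∷ ∂ p ⊗ r) ⊕ (scale a (∂ r) ⊕ (0ℚ ∷ p ⊗ ∂ r))
    ≈⟨ ⊕-cong (⊕-cong (≋-refl {p ⊗ r}) (0∷-⊗ (∂ p) r)) ≋-refl ⟨
  p ⊗ r ⊕ (0ℚ ∷ ∂ p) ⊗ r ⊕ (a ∷ p) ⊗ ∂ r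
    ≈⟨ ⊕-cong (⊗-distribʳ r p (0ℚ ∷ ∂ p)) ≋-refl ⟨
  (p ⊕ (0ℚ ∷ ∂ p)) ⊗ r ⊕ (a ∷ p) ⊗ ∂ r ∎

-- The factor X avoids the exponent k - 1.
X∂X^ : ∀ k → X ⊗ ∂ (X ^ k) ≋ (k · oneP) ⊗ X ^ k
X∂X^ zero    = ≋-trans (⊗-congˡ X 0∷[]≋[]) (⊗-zeroʳ X)
X∂X^ (suc k) = begin
  X ⊗ ∂ (X ⊗ X ^ k)
    ≈⟨ ⊗-congˡ X (∂-⊗ X (X ^ k)) ⟩
  X ⊗ (∂ X ⊗ X ^ k ⊕ X ⊗ ∂ (X ^ k))
    ≈⟨ ⊗-congˡ X (⊕-cong (⊗-congʳ (∂ X) oneP (X ^ k) (∷-cong ≡.refl 0∷[]≋[])) (X∂X^ k)) ⟩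
  X ⊗ (oneP ⊗ X ^ k ⊕ (k · oneP) ⊗ X ^ k)
    ≈⟨ solve 3 (λ x a n → x :* (:1 :* a :+ n :* a) := (:1 :+ n) :* (x :* a)) ≋-refl X (X ^ k) (k · oneP) ⟩
  (oneP ⊕ k · oneP) ⊗ (X ⊗ X ^ k) ∎

·-constant : ∀ k → Σ ℚ λ c → 0ℚ ℚ.≤ c × k · oneP ≋ c ∷ []
·-constant zero = 0ℚ , ℚ.≤-refl , ≋-sym 0∷[]≋[]
·-constant (suc k) with ·-constant k
... | c , 0≤c , e = 1ℚ ℚ.+ c , ℚ.+-mono-≤ {0ℚ} {1ℚ} (ℚ.*≤* (+≤+ ℕ.z≤n)) 0≤c , ⊕-cong ≋-refl e

·-unit : ∀ k → Unit (suc k · oneP)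
·-unit k with ·-constant k
... | c , 0≤c , e = (ℚ.1/ (1ℚ ℚ.+ c)) ∷ [] , ≋-trans (⊗-congʳ _ _ _ (⊕-cong (≋-refl {oneP}) e))
    (∷-cong (≡.trans (ℚ.+-identityʳ _) (ℚ.*-inverseʳ (1ℚ ℚ.+ c))) ≋-refl)
  where
  instance
    positive : ℚ.Positive (1ℚ ℚ.+ c)
    positive = ℚ.positive (ℚ.<-≤-trans (ℚ.positive⁻¹ 1ℚ) (≡.subst (ℚ._≤ 1ℚ ℚ.+ c) (ℚ.+-identityʳ 1ℚ) (ℚ.+-monoʳ-≤ 1ℚ 0≤c)))
    nonZero : ℚ.NonZero (1ℚ ℚ.+ c)
    nonZero = ℚ.pos⇒nonZero (1ℚ ℚ.+ c)

X^_−1 : ℕ → Poly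
X^ k −1 = X ^P k ⊕ negP oneP

X^−1≡ : ∀ k → X^ k −1 ≡ X ^ k ⊕ negP oneP
X^−1≡ k = ≡.cong (_⊕ negP oneP) (^P≡^ X k)

-- Separability of f = X^K - 1: Xf' - Kf = K is a unit, and for f = pr the product rule puts the
-- left side into the ideal of p and r.
factors-comaximal : ∀ k p r → p ⊗ r ≋ X^ suc k −1 → Comaximal p r
factors-comaximal k p r e = i ⊗ (X ⊗ ∂ r ⊕ negP (K ⊗ r)) , i ⊗ (X ⊗ ∂ p) , modulo₂ X∂ i (proj₂ (·-unit k)) oneP
  (solve 7 (λ i X K p r p′ r′ → i :* (X :* r′ :- K :* r) :* p :+ i :* (X :* p′) :* r :=
    :1 :+ i :* (X :* (p′ :* r :+ p :* r′) :- K :* (:1 :+ p :* r)) :+ :1 :* (K :* i :- :1)) ≋-refl i X K p r (∂ p) (∂ r))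
  where
  K i : Poly
  K = suc k · oneP
  i = proj₁ (·-unit k)
  power : X ^ suc k ≋ oneP ⊕ p ⊗ r
  power = ≋-trans (solve 1 (λ a → a := :1 :+ (a :- :1)) ≋-refl (X ^ suc k))
    (⊕-cong (≋-refl {oneP}) (≋-sym (≡.subst (p ⊗ r ≋_) (X^−1≡ (suc k)) e)))
  X∂ : X ⊗ (∂ p ⊗ r ⊕ p ⊗ ∂ r) ≋ K ⊗ (oneP ⊕ p ⊗ r)
  X∂ = begin
    X ⊗ (∂ p ⊗ r ⊕ p ⊗ ∂ r)     ≈⟨ ⊗-congˡ X (∂-⊗ p r) ⟨
    X ⊗ ∂ (p ⊗ r)               ≈⟨ ⊗-congˡ X (∂-cong _ _ e) ⟩
    X ⊗ ∂ (X^ suc k −1)         ≡⟨ ≡.cong (λ a → X ⊗ ∂ a) (X^−1≡ (suc k)) ⟩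
    X ⊗ ∂ (X ^ suc k ⊕ negP oneP)   ≈⟨ ⊗-congˡ X (≋-trans (∂-⊕ (X ^ suc k) (negP oneP)) (≋-trans (⊕-cong (≋-refl {∂ (X ^ suc k)}) 0∷[]≋[]) (⊕-identityʳ _))) ⟩
    X ⊗ ∂ (X ^ suc k)           ≈⟨ X∂X^ (suc k) ⟩
    K ⊗ X ^ suc k               ≈⟨ ⊗-congˡ K power ⟩
    K ⊗ (oneP ⊕ p ⊗ r)          ∎

X^−1-∣ : ∀ {a b} → a ℕ.∣ b → X^ a −1 ∣ X^ b −1
X^−1-∣ {a} {b} a∣b = ≡.subst₂ _∣_ (≡.sym (X^−1≡ a)) (≡.sym (X^−1≡ b)) (^-1-∣ X a∣b)

-- X^t - 1 = X^g (X^s - 1) + (X^g - 1), so modulo p the element X^g - 1 is a multiple of X^s - 1.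
comaximal-difference : ∀ {p} g s t → g ℕ.+ s ≡ t → Comaximal p (X^ g −1) → p ∣ X^ t −1 → Comaximal p (X^ s −1)
comaximal-difference {p} g s t ≡.refl (a , b , eq) (w , wp)
  rewrite X^−1≡ g | X^−1≡ s | X^−1≡ (g ℕ.+ s) = a ⊕ b ⊗ w , negP (b ⊗ X ^ g) ,
  modulo₂ eq oneP (≋-trans wp (⊕-cong (^-homo-* X g s) ≋-refl)) b
    (solve 6 (λ a b w p x y → (a :+ b :* w) :* p :+ :- (b :* x) :* (y :- :1) :=
      :1 :+ :1 :* (a :* p :+ b :* (x :- :1) :- :1) :+ b :* (w :* p :- (x :* y :- :1))) ≋-refl a b w p (X ^ g) (X ^ s))

comaximal-difference′ : ∀ {p} g s t → g ℕ.+ s ≡ t → Comaximal p (X^ g −1) → p ∣ X^ s −1 → Comaximal p (X^ t −1)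
comaximal-difference′ {p} g s t ≡.refl (a , b , eq) (w , wp)
  rewrite X^−1≡ g | X^−1≡ s | X^−1≡ (g ℕ.+ s) = a ⊕ negP (b ⊗ X ^ g ⊗ w) , b ,
  modulo₂ eq oneP wp (negP (b ⊗ X ^ g)) (≋-trans (⊕-cong (≋-refl {(a ⊕ negP (b ⊗ X ^ g ⊗ w)) ⊗ p}) (⊗-congˡ b (⊕-cong (^-homo-* X g s) ≋-refl)))
    (solve 6 (λ a b w p x y → (a :+ :- (b :* x :* w)) :* p :+ b :* (x :* y :- :1) :=
      :1 :+ :1 :* (a :* p :+ b :* (x :- :1) :- :1) :+ :- (b :* x) :* (w :* p :- (y :- :1))) ≋-refl a b w p (X ^ g) (X ^ s)))

-- Modulo p, where X^n = 1, the polynomial at the gcd is a multiple of X^j - 1. Bézout over ℕ has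
-- two forms, one for each difference lemma.
comaximal-gcd : ∀ {p} n j → p ∣ X^ n −1 → Comaximal p (X^ ℕ.gcd n j −1) → Comaximal p (X^ j −1)
comaximal-gcd {p} n j p∣ com with ℕ.Bézout.identity (ℕ.gcd-GCD n j)
... | ℕ.Bézout.+- x y eq = Comaximal-sym (Comaximal-∣ (X^−1-∣ (ℕ.n∣m*n y))
  (Comaximal-sym (comaximal-difference (ℕ.gcd n j) (y ℕ.* j) (x ℕ.* n) eq com (∣-trans p∣ (X^−1-∣ (ℕ.n∣m*n x))))))
... | ℕ.Bézout.-+ x y eq = Comaximal-sym (Comaximal-∣ (X^−1-∣ (ℕ.n∣m*n y))
  (Comaximal-sym (comaximal-difference′ (ℕ.gcd n j) (x ℕ.* n) (y ℕ.* j) eq com (∣-trans p∣ (X^−1-∣ (ℕ.n∣m*n x))))))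

lastPoly-++ : ∀ xs x → lastPoly (xs ++ [ x ]) ≡ proj₂ x
lastPoly-++ []           x = ≡.refl
lastPoly-++ (y ∷ [])     x = ≡.refl
lastPoly-++ (y ∷ z ∷ xs) x = lastPoly-++ (z ∷ xs) x

multiplyIf : ℕ → ℕ × Poly → Poly → Poly
multiplyIf N dφ acc = if ⌊ proj₁ dφ ℕ.∣? N ⌋ then proj₂ dφ ⊗ acc else acc

-- a times the product of Φ d over the divisors d ≤ k of N.
divisorProduct : ℕ → ℕ → Poly → Poly
divisorProduct N k a = foldr (multiplyIf N) a (phis k)

Φ-suc : ∀ k → Φ (suc k) ≡ divMonic (X^ suc k −1) (divisorProduct (suc k) k oneP)
Φ-suc k = lastPoly-++ (phis k) _

divisorProduct-suc : ∀ N k a → divisorProduct N (suc k) a ≡ divisorProduct N k (multiplyIf N (suc k , Φ (suc k)) a)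
divisorProduct-suc N k a = ≡.trans (List.foldr-++ (multiplyIf N) a (phis k) _)
  (≡.cong (λ φ → divisorProduct N k (multiplyIf N (suc k , φ) a)) (≡.sym (Φ-suc k)))

-- `foldr` meets the largest index first, so `P k a` describes the accumulator while the indices up
-- to `k` are still to come.
divisorProduct-induction : ∀ N (P : ℕ → Poly → Set) →
  (∀ k a → suc k ℕ.∣ N → P (suc k) a → P k (Φ (suc k) ⊗ a)) →
  (∀ k a → P (suc k) a → P k a) →
  ∀ k a → P k a → P 0 (divisorProduct N k a)
divisorProduct-induction N P take skip zero    a pa = pa
divisorProduct-induction N P take skip (suc k) a pa rewrite divisorProduct-suc N k a with suc k ℕ.∣? N
... | yes k∣N = divisorProduct-induction N P take skip k (Φ (suc k) ⊗ a) (take k a k∣N pa)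
... | no  _   = divisorProduct-induction N P take skip k a (skip k a pa)

∣-divisorProduct : ∀ N k {p a} → p ∣ a → p ∣ divisorProduct N k a
∣-divisorProduct N k {p} {a} = divisorProduct-induction N (λ _ a → p ∣ a) (λ k a _ → ∣-*ˡ (Φ (suc k))) (λ _ _ p∣a → p∣a) k a

Φ∣divisorProduct : ∀ N k a d → d ℕ.< k → suc d ℕ.∣ N → Φ (suc d) ∣ divisorProduct N k a
Φ∣divisorProduct N (suc k) a d (ℕ.s≤s d≤k) d∣N rewrite divisorProduct-suc N k a with suc k ℕ.∣? N | ℕ.m≤n⇒m<n∨m≡n d≤k
... | yes _   | inj₁ d<k = Φ∣divisorProduct N k _ d d<k d∣N
... | no  _   | inj₁ d<k = Φ∣divisorProduct N k _ d d<k d∣N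
... | yes _   | inj₂ ≡.refl = ∣-divisorProduct N k (a , ⊗-comm a _)
... | no  d∤N | inj₂ ≡.refl = contradiction d∣N d∤N

Comaximal-divisorProduct : ∀ N k {p} → (∀ d → d ℕ.< k → suc d ℕ.∣ N → Comaximal (Φ (suc d)) p) →
                           Comaximal (divisorProduct N k oneP) p
Comaximal-divisorProduct N k {p} com = proj₁ (divisorProduct-induction N
  (λ j a → Comaximal a p × j ℕ.≤ k)
  (λ j a j∣N (ca , j<k) → Comaximal-* (com j j<k j∣N) ca , ℕ.<⇒≤ j<k)
  (λ j a (ca , j<k) → ca , ℕ.<⇒≤ j<k) k oneP (Comaximal-1 , ℕ.≤-refl))

-- Proved together by strong induction: the division that defines Φ at N is exact because the
-- earlier Φ are monic and pairwise comaximal.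
record IsCyclotomic (k : ℕ) : Set where
  field
    monic     : Monic (Φ (suc k))
    factor    : Φ (suc k) ⊗ divisorProduct (suc k) k oneP ≋ X^ suc k −1
    comaximal : ∀ j → ¬ suc k ℕ.∣ j → Comaximal (Φ (suc k)) (X^ j −1)

  Φ∣X^−1 : Φ (suc k) ∣ X^ suc k −1
  Φ∣X^−1 = divisorProduct (suc k) k oneP , ≋-trans (⊗-comm _ (Φ (suc k))) factor

open IsCyclotomic

X^−1-monic : ∀ k → Monic (X^ suc k −1)
X^−1-monic k rewrite X^−1≡ (suc k) = suc k , (≡.trans (coeff-⊕ (X ^ suc k) (negP oneP) (suc k)) (≡.trans (ℚ.+-identityʳ _) (proj₁ (Top-X^ (suc k))))
  , λ { (suc i) k<i → ≡.trans (coeff-⊕ (X ^ suc k) (negP oneP) (suc i)) (≡.trans (ℚ.+-identityʳ _) (proj₂ (Top-X^ (suc k)) (suc i) k<i)) })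
  where
  Top-X^ : ∀ k → Top k 1ℚ (X ^ k)
  Top-X^ zero    = ≡.refl , λ { (suc i) _ → ≡.refl }
  Top-X^ (suc k) = Top-monic-⊗ X (X ^ k) (≡.refl , λ { (suc zero) (ℕ.s≤s ()) ; (suc (suc i)) _ → ≡.refl }) (Top-X^ k)

isCyclotomic-step : ∀ k → (∀ d → d ℕ.< k → IsCyclotomic d) → IsCyclotomic k
isCyclotomic-step k ih = record
  { monic     = Monic-cancel (divisorProduct N k oneP) (Φ N) product-monic (Monic-resp (≋-trans (≋-sym factor′) (⊗-comm (Φ N) _)) (X^−1-monic k))
  ; factor    = factor′
  ; comaximal = comaximal′ }
  where
  N = suc k
  Monic-resp : ∀ {p r} → p ≋ r → Monic p → Monic r
  Monic-resp {p} e (D , t) = D , Top-resp {p = p} e t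
  product-monic : Monic (divisorProduct N k oneP)
  product-monic = proj₁ (divisorProduct-induction N (λ j a → Monic a × j ℕ.≤ k)
    (λ j a _ (ma , j<k) → Monic-⊗ {Φ (suc j)} (monic (ih j j<k)) ma , ℕ.<⇒≤ j<k)
    (λ j a (ma , j<k) → ma , ℕ.<⇒≤ j<k) k oneP ((0 , ≡.refl , λ { (suc i) _ → ≡.refl }) , ℕ.≤-refl))
  Φ-Φ : ∀ d j → d ℕ.< j → j ℕ.< k → Comaximal (Φ (suc j)) (Φ (suc d))
  Φ-Φ d j d<j j<k = Comaximal-sym (Comaximal-∣ (Φ∣X^−1 (ih d (ℕ.<-trans d<j j<k)))
    (Comaximal-sym (comaximal (ih j j<k) (suc d) (ℕ.>⇒∤ (ℕ.s≤s d<j)))))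
  -- Pairwise comaximal divisors of X^N - 1 have a product dividing it; the accumulator is kept
  -- comaximal to every Φ still to come.
  product-∣ : divisorProduct N k oneP ∣ X^ N −1
  product-∣ = proj₁ (divisorProduct-induction N
    (λ j a → a ∣ X^ N −1 × (∀ d → d ℕ.< j → Comaximal a (Φ (suc d))) × j ℕ.≤ k)
    (λ j a j∣N (a∣ , com , j<k) →
        *-∣ (Comaximal-sym (com j ℕ.≤-refl)) (∣-trans (Φ∣X^−1 (ih j j<k)) (X^−1-∣ j∣N)) a∣
      , (λ d d<j → Comaximal-* (Φ-Φ d j d<j j<k) (com d (ℕ.m<n⇒m<1+n d<j)))
      , ℕ.<⇒≤ j<k)
    (λ j a (a∣ , com , j<k) → a∣ , (λ d d<j → com d (ℕ.m<n⇒m<1+n d<j)) , ℕ.<⇒≤ j<k)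
    k oneP ((X^ N −1 , ≋-trans (⊗-comm _ oneP) (⊗-identityˡ _)) , (λ _ _ → Comaximal-1) , ℕ.≤-refl))
  factor′ : Φ N ⊗ divisorProduct N k oneP ≋ X^ N −1
  factor′ = ≡.subst (λ φ → φ ⊗ divisorProduct N k oneP ≋ X^ N −1) (≡.sym (Φ-suc k))
    (divMonic-exact (X^ N −1) (divisorProduct N k oneP) product-monic product-∣)
  Φ-product : Comaximal (divisorProduct N k oneP) (Φ N)
  Φ-product = Comaximal-sym (factors-comaximal k (Φ N) (divisorProduct N k oneP) factor′)
  Φ-Φ′ : ∀ d → d ℕ.< k → suc d ℕ.∣ N → Comaximal (Φ (suc d)) (Φ N)
  Φ-Φ′ d d<k d∣N = Comaximal-∣ (Φ∣divisorProduct N k oneP d d<k d∣N) Φ-product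
  -- X^(g+1) - 1 is the product of Φ over the divisors of g + 1. These are proper divisors of N, so
  -- each such Φ divides the cofactor of Φ at N, which is comaximal to Φ at N by separability.
  Φ-X^g−1 : ∀ g → g ℕ.< k → suc g ℕ.∣ N → Comaximal (X^ suc g −1) (Φ N)
  Φ-X^g−1 g g<k g∣N = Comaximal-∣ (oneP , ≋-trans (⊗-identityˡ _) (≋-sym (factor (ih g g<k))))
    (Comaximal-* (Φ-Φ′ g g<k g∣N) (Comaximal-divisorProduct (suc g) g λ d d<g d∣g → Φ-Φ′ d (ℕ.<-trans d<g g<k) (ℕ.∣-trans d∣g g∣N)))
  -- The gcd of N and j is a proper divisor of N, since N does not divide j.
  comaximal′ : ∀ j → ¬ N ℕ.∣ j → Comaximal (Φ N) (X^ j −1)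
  comaximal′ j N∤j = comaximal-gcd N j (divisorProduct N k oneP , ≋-trans (⊗-comm _ (Φ N)) factor′) (at-gcd (ℕ.gcd N j) ≡.refl)
    where
    at-gcd : ∀ g → ℕ.gcd N j ≡ g → Comaximal (Φ N) (X^ ℕ.gcd N j −1)
    at-gcd zero    e = contradiction (ℕ.gcd[m,n]≡0⇒m≡0 {N} {j} e) λ ()
    at-gcd (suc g) e rewrite e = Comaximal-sym (Φ-X^g−1 g (ℕ.s≤s⁻¹ (ℕ.≤∧≢⇒< (ℕ.∣⇒≤ g∣N) g≢N)) g∣N)
      where
      g∣N : suc g ℕ.∣ N
      g∣N = ≡.subst (ℕ._∣ N) e (ℕ.gcd[m,n]∣m N j)
      g≢N : suc g ≢ N
      g≢N ≡.refl = N∤j (≡.subst (ℕ._∣ j) e (ℕ.gcd[m,n]∣n N j))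

isCyclotomic : ∀ k → IsCyclotomic k
isCyclotomic k = below (suc k) k ℕ.≤-refl
  where
  below : ∀ n d → d ℕ.< n → IsCyclotomic d
  below (suc n) d (ℕ.s≤s d≤n) = isCyclotomic-step d λ e e<d → below n e (ℕ.<-≤-trans e<d d≤n)

-- Transfer to the fractions and congruences of the statement.

open HypergeometricSum ℚ[X] X

poch≡poch′ : ∀ a b k → poch a b k ≡ poch′ a b k
poch≡poch′ a b zero    = ≡.refl
poch≡poch′ a b (suc k) = ≡.cong₂ (λ p e → p ⊗ (oneP ⊕ negP (a ⊗ e))) (poch≡poch′ a b k) (^P≡^ b k)

poch-X : ∀ r k → poch (X ^P r) (X ^P 4) k ≡ poch′ (X ^ r) (X ^ 4) k
poch-X r k = ≡.trans (poch≡poch′ (X ^P r) (X ^P 4) k) (≡.cong₂ (λ a b → poch′ a b k) (^P≡^ X r) (^P≡^ X 4))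

term≡term′ : ∀ k → term k ≡ term′ k
term≡term′ k = ≡.cong₂ _,_
  (≡.cong₂ _⊗_ (≡.cong₂ _⊗_ (≡.cong (oneP ⊕_) (^P≡^ X (4 ℕ.* k ℕ.+ 1))) (cube (poch-X 2 k))) (^P≡^ X k))
  (≡.cong ((oneP ⊕ X) ⊗_) (cube (poch-X 4 k)))
  where
  cube : ∀ {p r} → p ≡ r → p ^P 3 ≡ r ^ 3
  cube {p} e = ≡.trans (^P≡^ p 3) (≡.cong (_^ 3) e)

S≡S′ : ∀ k → S k ≡ S′ k
S≡S′ zero    = ≡.refl
S≡S′ (suc k) = ≡.cong₂ _+F_ (S≡S′ k) (term≡term′ k)

divisible⇒≡0 : ∀ (F : Frac) (m : Poly) → (Σ Poly λ U → Σ Poly λ V → Comaximal V m × num F ⊗ V ≋ den F ⊗ m ⊗ U) → F ≡ zeroF mod m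
divisible⇒≡0 (a , b) m (U , V , (c , d , eq) , aV) = U , V , (c , d , _≋_.coeffs eq) , _≋_.coeffs
  (≋-trans (solve 3 (λ a b V → (a :* :1 :+ :- (con (+ 0) :* b)) :* V := a :* V) ≋-refl a b V)
    (≋-trans aV (solve 3 (λ b m U → b :* m :* U := b :* :1 :* m :* U) ≋-refl b m U)))

open import Data.Nat using (ℕ; _+_; _*_; _∸_; _/_; _%_; _≤_)

module _ (m M : ℕ) where
  private
    n = 4 * M + 3

    n≡1+[4M+2] : n ≡ suc (4 * M + 2)
    n≡1+[4M+2] = ℕ.+-suc (4 * M) 2

    module Cyclotomic = IsCyclotomic (isCyclotomic (4 * M + 2))

    Φ∣X^n-1 : Φ n ∣ X ^ n ⊕ negP oneP
    Φ∣X^n-1 = ≡.subst (λ i → Φ i ∣ X ^ i ⊕ negP oneP) (≡.sym n≡1+[4M+2])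
      (≡.subst (Φ (suc (4 * M + 2)) ∣_) (X^−1≡ (suc (4 * M + 2))) Cyclotomic.Φ∣X^−1)

    Φ-comaximal : ∀ j → ¬ (n ℕ.∣ j) → Comaximal (Φ n) (X ^ j ⊕ negP oneP)
    Φ-comaximal = ≡.subst (λ i → ∀ j → ¬ (i ℕ.∣ j) → Comaximal (Φ i) (X ^ j ⊕ negP oneP)) (≡.sym n≡1+[4M+2])
      (λ j n∤j → ≡.subst (Comaximal (Φ (suc (4 * M + 2)))) (X^−1≡ j) (Cyclotomic.comaximal j n∤j))

    open Supercongruence.AtRoot ℚ[X] X (Φ n) M Φ∣X^n-1 Φ-comaximal ·-unit using (Divisible; supercongruence)

    divisible⇒S≡0 : ∀ k → Divisible (S′ k) → S k ≡ zeroF mod (Φ n ^P 2)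
    divisible⇒S≡0 k d = ≡.subst (λ modulus → S k ≡ zeroF mod modulus) (≡.sym (^P≡^ (Φ n) 2))
      (≡.subst (λ F → F ≡ zeroF mod (Φ n ^ 2)) (≡.sym (S≡S′ k)) (divisible⇒≡0 (S′ k) _ d))

    half : (n ∸ 1) / 2 ≡ 2 * M + 1
    half = ≡.trans (≡.cong (_/ 2) (≡.trans (≡.cong (_∸ 1) n≡1+[4M+2])
        (solveℕ 1 (λ M → conℕ 4 ⊗ℕ M ⊕ℕ conℕ 2 ⊜ℕ (conℕ 2 ⊗ℕ M ⊕ℕ conℕ 1) ⊗ℕ conℕ 2) ≡.refl M)))
      (ℕ.m*n/n≡m (2 * M + 1) 2)

    -- `S c` adds the terms with k < c, so an inclusive upper limit costs one more.
    endpoint : m * n + suc (2 * M + 1) ≡ m * n + (n ∸ 1) / 2 + 1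
    endpoint = ≡.trans (≡.cong (λ i → m * n + i) (≡.trans (ℕ.+-comm 1 _) (≡.cong (_+ 1) (≡.sym half)))) (≡.sym (ℕ.+-assoc (m * n) _ 1))

  congruence-4M+3 : (S (m * n) ≡ zeroF mod (Φ n ^P 2)) × (S (m * n + (n ∸ 1) / 2 + 1) ≡ zeroF mod (Φ n ^P 2))
  congruence-4M+3 = divisible⇒S≡0 (m * n) (proj₁ (supercongruence m))
    , ≡.subst (λ i → S i ≡ zeroF mod (Φ n ^P 2)) endpoint
        (divisible⇒S≡0 (m * n + suc (2 * M + 1)) (proj₂ (supercongruence m)))

theorem1p1 : (m n : ℕ) → 1 ≤ m → 1 ≤ n → n % 4 ≡ 3 →
    (S (m * n) ≡ zeroF mod (Φ n ^P 2))
    × (S (m * n + (n ∸ 1) / 2 + 1) ≡ zeroF mod (Φ n ^P 2))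
theorem1p1 m n _ _ n%4≡3 = ≡.subst
  (λ n → (S (m * n) ≡ zeroF mod (Φ n ^P 2)) × (S (m * n + (n ∸ 1) / 2 + 1) ≡ zeroF mod (Φ n ^P 2)))
  (≡.sym n≡4M+3) (congruence-4M+3 m (n / 4))
  where
  n≡4M+3 : n ≡ 4 * (n / 4) + 3
  n≡4M+3 = ≡.trans (ℕ.m≡m%n+[m/n]*n n 4) (≡.trans (≡.cong (λ r → r + n / 4 * 4) n%4≡3)
    (≡.trans (ℕ.+-comm 3 (n / 4 * 4)) (≡.cong (_+ 3) (ℕ.*-comm (n / 4) 4))))
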